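{- The minimal unavoidable sets of length two are precisely the sets $O_1,O_2,\dots,O_9$ and their reversals, where \begin{align*} O_1 &= \{(1,1), (1,2),(2,1),(1,3)\},\\ O_2 &= \{(1,1), (1,2),(2,2),(1,3),(1,4)\},\\ O_3 &= \{(1,1),(1,2),(2,2),(1,3),(4,1),(4,2)\},\\ O_4 &=\{(1,1), (1,2),(2,2),(3,1),(3,2),(4,1),(4,2),(1,5)\},\\ O_5 &=\{(1,1), (1,2),(2,2),(3,1),(3,2),(4,1),(4,2),(5,2)\},\\ O_6 &=\{(1,1), (1,2),(2,2),(3,1),(3,2),(1,4),(4,2),(1,5)\},\\ O_7 &=\{(1,1), (1,2),(2,2),(3,1),(3,2),(1,4),(4,2),(5,2)\},\\ O_8 &=\{(1,1), (1,2),(2,2),(3,1),(3,2), (1,4),(3,4),(1,5)\},\\ O_9 &=\{(1,1), (1,2),(2,2),(3,1),(3,2), (1,4),(3,4),(5,2)\}. \end{align*}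
   Context: A triangulated polygon is a polygon with at least three vertices, divided into triangles by pairwise non-crossing diagonals. Label each vertex by the number of triangles incident to it. A quiddity sequence is the finite sequence of all these labels, read clockwise around the polygon starting from any vertex. A trimmed quiddity sequence is a word obtained by removing the last entry of a quiddity sequence. For example, $(1,2,1,2)$ is a quiddity sequence (of a triangulated quadrilateral) and $(1,2,1)$ is a trimmed quiddity sequence. A word is a nonempty finite sequence. A word $x$ is a substring of a word $(b_0,\dots,b_m)$ if $x=(b_r,b_{r+1},\dots,b_s)$ for some $0\leq r\leq s\leq m$. A set $X$ of words is without redundancy if no element of $X$ is a substring of another element of $X$. The reversal of $X$ is the set obtained by reversing each word of $X$. A finite set $X$ of words of positive integers, without redundancy, is an unavoidable set if each trimmed quiddity sequence has a substring that belongs to $X$. The length of $X$ is the supremum of the lengths of its words. Finite unavoidable sets are partially ordered by $X\preceq Y$ iff every $x\in X$ contains some $y\in Y$ as a substring. A minimal unavoidable set of length $L$ is a minimal element of the poset of finite unavoidable sets of length $L$. -}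

module Defs where

open import Data.Fin using (Fin; toℕ; _<_; _≟_; _<?_)
open import Data.List
  using (List; []; _∷_; _++_; _∷ʳ_; length; map; filter; allFin;
         cartesianProduct; tabulate; take; drop; reverse)
open import Data.List.Extrema.Nat using (max)
open import Data.List.Membership.Propositional using (_∈_)
open import Data.List.Relation.Binary.BagAndSetEquality using (_∼[_]_; set)
open import Data.List.Relation.Binary.Infix.Heterogeneous using (Infix)
open import Data.List.Relation.Unary.All using (All)
open import Data.Nat as ℕ using (ℕ; suc)
import Data.Nat.Properties as ℕ
open import Data.Product using (Σ; _×_; _,_; ∃-syntax)
open import Data.Sum using (_⊎_)
open import Function.Bundles using (_⇔_)
open import Level using (0ℓ)
open import Relation.Binary using (Rel; Decidable)
open import Relation.Binary.PropositionalEquality using (_≡_; _≢_)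
open import Relation.Nullary using (¬_; Dec)
open import Relation.Nullary.Decidable using (_×-dec_; _⊎-dec_)

-- The vertices of an n-gon are numbered clockwise by Fin n.  An unordered
-- pair of distinct vertices {i , j} is always presented with i < j.

Side : ∀ {n} → Rel (Fin n) 0ℓ
Side {n} i j = suc (toℕ i) ≡ toℕ j ⊎ (toℕ i ≡ 0 × suc (toℕ j) ≡ n)

side? : ∀ {n} → Decidable (Side {n})
side? {n} i j =
  (suc (toℕ i) ℕ.≟ toℕ j) ⊎-dec ((toℕ i ℕ.≟ 0) ×-dec (suc (toℕ j) ℕ.≟ n))

Crosses : ∀ {n} → (i j k l : Fin n) → Set
Crosses i j k l = i < k × k < j × j < l

-- Let Joined be the sides of an n-gon together with some pairwise
-- non-crossing diagonals.  The pieces into which these diagonals divide the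
-- n-gon are the sub-polygons all of whose sides are joined and none of whose
-- diagonals are.
record Piece {n} (Joined : Rel (Fin n) 0ℓ) (k : ℕ) : Set where
  field
    corner     : Fin k → Fin n
    increasing : ∀ {a b} → a < b → corner a < corner b
    sides-only : ∀ {a b} → a < b → Joined (corner a) (corner b) ⇔ Side a b

record TriangulatedPolygon : Set₁ where
  field
    n   : ℕ
    3≤n : 3 ℕ.≤ n

    Diagonal  : Rel (Fin n) 0ℓ
    diagonal? : Decidable Diagonal
    ordered   : ∀ {i j} → Diagonal i j → i < j
    not-side  : ∀ {i j} → Diagonal i j → ¬ Side i j

    -- The case of (k , l) crossing (i , j) from the other side follows by
    -- exchanging the two diagonals.
    non-crossing : ∀ {i j k l} → Diagonal i j → Diagonal k l → ¬ Crosses i j k l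

  Joined : Rel (Fin n) 0ℓ
  Joined i j = Side i j ⊎ Diagonal i j

  joined? : Decidable Joined
  joined? i j = side? i j ⊎-dec diagonal? i j

  field
    divided-into-triangles : ∀ {k} → 3 ℕ.≤ k → Piece Joined k → k ≡ 3

  -- The pieces with three corners: a 3-gon has no diagonals, so being a piece
  -- only requires its corners to be pairwise joined.
  Triangle : Fin n × Fin n × Fin n → Set
  Triangle (i , j , k) = i < j × j < k × Joined i j × Joined j k × Joined i k

  triangle? : ∀ t → Dec (Triangle t)
  triangle? (i , j , k) =
    (i <? j) ×-dec (j <? k) ×-dec joined? i j ×-dec joined? j k ×-dec joined? i k

  Incident : Fin n → Fin n × Fin n × Fin n → Set
  Incident v (i , j , k) = v ≡ i ⊎ v ≡ j ⊎ v ≡ k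

  incident? : ∀ v t → Dec (Incident v t)
  incident? v (i , j , k) = (v ≟ i) ⊎-dec (v ≟ j) ⊎-dec (v ≟ k)

  triangles : List (Fin n × Fin n × Fin n)
  triangles =
    filter triangle? (cartesianProduct (allFin n) (cartesianProduct (allFin n) (allFin n)))

  label : Fin n → ℕ
  label v = length (filter (incident? v) triangles)

  labels : List ℕ
  labels = tabulate label

  labelsFrom : Fin n → List ℕ
  labelsFrom v = drop (toℕ v) labels ++ take (toℕ v) labels

QuidditySequence : List ℕ → Set₁
QuidditySequence q = Σ TriangulatedPolygon λ P →
  let open TriangulatedPolygon P in ∃[ v ] q ≡ labelsFrom v

TrimmedQuidditySequence : List ℕ → Set₁
TrimmedQuidditySequence w = ∃[ a ] QuidditySequence (w ∷ʳ a)

-- Nonemptiness of words is imposed in the definition of Unavoidable.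

Word : Set
Word = List ℕ

_IsSubstringOf_ : Rel Word 0ℓ
_IsSubstringOf_ = Infix _≡_

-- Finite sets of words are lists, compared by _≈_ (order and multiplicity of
-- the entries are irrelevant).

WordSet : Set
WordSet = List Word

infix 4 _≈_ _≼_

_≈_ : Rel WordSet 0ℓ
X ≈ Y = X ∼[ set ] Y

WithoutRedundancy : WordSet → Set
WithoutRedundancy X = ∀ {x y} → x ∈ X → y ∈ X → x IsSubstringOf y → x ≡ y

reversal : WordSet → WordSet
reversal = map reverse

record Unavoidable (X : WordSet) : Set₁ where
  field
    nonempty           : All (_≢ []) X
    positive           : All (All (0 ℕ.<_)) X
    without-redundancy : WithoutRedundancy X
    unavoidable        : ∀ {w} → TrimmedQuidditySequence w →
                         ∃[ x ] x ∈ X × x IsSubstringOf w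

setLength : WordSet → ℕ
setLength X = max 0 (map length X)

_≼_ : Rel WordSet 0ℓ
X ≼ Y = ∀ {x} → x ∈ X → ∃[ y ] y ∈ Y × y IsSubstringOf x

UnavoidableOfLength : ℕ → WordSet → Set₁
UnavoidableOfLength L X = Unavoidable X × setLength X ≡ L

MinimalUnavoidable : ℕ → WordSet → Set₁
MinimalUnavoidable L X =
  UnavoidableOfLength L X × (∀ Y → UnavoidableOfLength L Y → Y ≼ X → Y ≈ X)

pairs : List (ℕ × ℕ) → WordSet
pairs = map λ (a , b) → a ∷ b ∷ []

O₁ O₂ O₃ O₄ O₅ O₆ O₇ O₈ O₉ : WordSet
O₁ = pairs ((1 , 1) ∷ (1 , 2) ∷ (2 , 1) ∷ (1 , 3) ∷ [])
O₂ = pairs ((1 , 1) ∷ (1 , 2) ∷ (2 , 2) ∷ (1 , 3) ∷ (1 , 4) ∷ [])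
O₃ = pairs ((1 , 1) ∷ (1 , 2) ∷ (2 , 2) ∷ (1 , 3) ∷ (4 , 1) ∷ (4 , 2) ∷ [])
O₄ = pairs ((1 , 1) ∷ (1 , 2) ∷ (2 , 2) ∷ (3 , 1) ∷ (3 , 2) ∷ (4 , 1) ∷ (4 , 2) ∷ (1 , 5) ∷ [])
O₅ = pairs ((1 , 1) ∷ (1 , 2) ∷ (2 , 2) ∷ (3 , 1) ∷ (3 , 2) ∷ (4 , 1) ∷ (4 , 2) ∷ (5 , 2) ∷ [])
O₆ = pairs ((1 , 1) ∷ (1 , 2) ∷ (2 , 2) ∷ (3 , 1) ∷ (3 , 2) ∷ (1 , 4) ∷ (4 , 2) ∷ (1 , 5) ∷ [])
O₇ = pairs ((1 , 1) ∷ (1 , 2) ∷ (2 , 2) ∷ (3 , 1) ∷ (3 , 2) ∷ (1 , 4) ∷ (4 , 2) ∷ (5 , 2) ∷ [])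
O₈ = pairs ((1 , 1) ∷ (1 , 2) ∷ (2 , 2) ∷ (3 , 1) ∷ (3 , 2) ∷ (1 , 4) ∷ (3 , 4) ∷ (1 , 5) ∷ [])
O₉ = pairs ((1 , 1) ∷ (1 , 2) ∷ (2 , 2) ∷ (3 , 1) ∷ (3 , 2) ∷ (1 , 4) ∷ (3 , 4) ∷ (5 , 2) ∷ [])

O₁₋₉ : List WordSet
O₁₋₉ = O₁ ∷ O₂ ∷ O₃ ∷ O₄ ∷ O₅ ∷ O₆ ∷ O₇ ∷ O₈ ∷ O₉ ∷ []

module Submission where

-- A triangulated polygon is a binary tree: the triangle on the side from the
-- first to the last vertex cuts it into two smaller polygons.
--
-- Suppose that dᵢ₋₁ + dᵢ₊₁ = cᵢ dᵢ, where the cᵢ are the labels.  Then d changes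
-- sign after one turn around the polygon.  So d₀ = 0, d₁ = 1 gives dₙ = 0 at the
-- end of the trimmed sequence.  But if the trimmed sequence contains no pair of
-- Oᵢ, then each dᵢ₊₁ / dᵢ is bounded below by a positive constant that depends
-- only on the class of cᵢ, so that no dₙ vanishes.  Hence Oᵢ is unavoidable, and
-- by symmetry so is its reversal.
--
-- Conversely, an unavoidable set X of length two has to contain a pair (or one
-- of its letters) of each of a few trimmed sequences, and this forces Oᵢ ≼ X or
-- reversal Oᵢ ≼ X for some i.  Most of these sequences are fixed.  In the others
-- copies of a polygon form a fan around a centre whose label, being large, does
-- not occur in X.

open import Defs
open import Data.Empty using (⊥; ⊥-elim)
open import Data.Fin as Fin using (Fin; zero; suc; toℕ; fromℕ; fromℕ<)
open import Data.Fin.Induction using (>-wellFounded)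
import Data.Fin.Properties as Fin
open import Data.Integer as ℤ using (ℤ; +_; -_)
import Data.Integer.Properties as ℤ
open import Data.Integer.Tactic.RingSolver using (solve-∀)
open import Data.List
  using (List; []; _∷_; _++_; _∷ʳ_; allFin; cartesianProduct; concat; drop; filter; foldl; iterate;
         length; map; reverse; tabulate; take)
open import Data.List.Extrema.Nat using (max; max≤v⁺; xs≤max)
open import Data.List.Membership.Propositional using (_∈_; lose)
open import Data.List.Membership.Propositional.Properties
open import Data.List.Membership.Propositional.Properties.WithK using (unique∧set⇒bag)
open import Data.List.Properties
open import Data.List.Relation.Binary.BagAndSetEquality using (∼bag⇒↭)
open import Data.List.Relation.Binary.Infix.Heterogeneous
  using (here; there; toView; MkView; _++ⁱ_; _ⁱ++_)
import Data.List.Relation.Binary.Infix.Heterogeneous.Properties as Infix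
open import Data.List.Relation.Binary.Permutation.Propositional using (_↭_)
open import Data.List.Relation.Binary.Permutation.Propositional.Properties using (filter-↭; ↭-length)
open import Data.List.Relation.Binary.Pointwise as Pointwise using (Pointwise-≡⇒≡)
open import Data.List.Relation.Binary.Prefix.Heterogeneous using ([]; _∷_)
open import Data.List.Relation.Unary.All as All using (All; []; _∷_)
import Data.List.Relation.Unary.All.Properties as All
open import Data.List.Relation.Unary.AllPairs using ([]; _∷_)
open import Data.List.Relation.Unary.Any as Any using (Any; here; there)
import Data.List.Relation.Unary.Any.Properties as Any
open import Data.List.Relation.Unary.Linked as Linked using (Linked; []; [-]; _∷_; linked?)
open import Data.List.Relation.Unary.Unique.Propositional using (Unique)
import Data.List.Relation.Unary.Unique.Propositional.Properties as Unique
open import Data.Nat as ℕ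
  using (ℕ; zero; suc; pred; _+_; _*_; _∸_; _⊓_; _<_; _≤_; z≤n; s≤s; s≤s⁻¹; >-nonZero)
open import Data.Nat.Induction using (<-wellFounded)
open import Data.Nat.Properties
open import Data.Nat.Tactic.RingSolver using () renaming (solve-∀ to ℕ-solve-∀)
open import Data.Product using (Σ; _×_; _,_; ∃-syntax; proj₁; proj₂; swap)
open import Data.Sum using (_⊎_; inj₁; inj₂)
open import Data.Vec using (Vec; lookup; []; _∷_)
import Data.Vec.Functional as Vector
open import Function using (_∘_; id)
open import Function.Bundles using (_⇔_; mk⇔; Equivalence)
open import Induction.WellFounded using (Acc; acc)
open import Level using (0ℓ)
open import Relation.Binary using (Rel; Decidable)
open import Relation.Binary.Definitions using (tri<; tri≈; tri>)
open import Relation.Binary.PropositionalEquality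
open import Relation.Nullary using (¬_; Dec; yes; no)
open import Relation.Nullary.Decidable
  using (True; toWitness; ¬?; _×-dec_; _⊎-dec_; _→-dec_)
import Relation.Unary as U
open import Data.List.Membership.DecPropositional (≡-dec ℕ._≟_) using (_∈?_)

-- Trees and the recurrence dᵢ₋₁ + dᵢ₊₁ = cᵢ dᵢ

-- `leaf` is a bare side, a polygon without triangles; `node l r` glues `l` and `r` to the two other
-- sides of the triangle on the base.
data Tree : Set where
  leaf : Tree
  node : Tree → Tree → Tree

startLabel endLabel : Tree → ℕ
startLabel leaf       = 0
startLabel (node l r) = suc (startLabel l)
endLabel leaf       = 0
endLabel (node l r) = suc (endLabel r)

innerLabels : Tree → List ℕ
innerLabels leaf       = []
innerLabels (node l r) =
  innerLabels l ++ suc (endLabel l + startLabel r) ∷ innerLabels r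

trim quiddity : Tree → List ℕ
trim t     = startLabel t ∷ innerLabels t
quiddity t = trim t ∷ʳ endLabel t

mirror : Tree → Tree
mirror leaf       = leaf
mirror (node l r) = node (mirror r) (mirror l)

startLabel-mirror : ∀ t → startLabel (mirror t) ≡ endLabel t
startLabel-mirror leaf       = refl
startLabel-mirror (node l r) = cong suc (startLabel-mirror r)

endLabel-mirror : ∀ t → endLabel (mirror t) ≡ startLabel t
endLabel-mirror leaf       = refl
endLabel-mirror (node l r) = cong suc (endLabel-mirror l)

innerLabels-mirror : ∀ t → innerLabels (mirror t) ≡ reverse (innerLabels t)
innerLabels-mirror leaf       = refl
innerLabels-mirror (node l r) = begin
  innerLabels (mirror r) ++ suc (endLabel (mirror r) + startLabel (mirror l)) ∷ innerLabels (mirror l)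
    ≡⟨ cong₂ _++_ (innerLabels-mirror r) (cong₂ _∷_ (cong suc apex) (innerLabels-mirror l)) ⟩
  reverse R ++ c ∷ reverse L
    ≡⟨ ++-assoc (reverse R) (c ∷ []) (reverse L) ⟨
  (reverse R ++ c ∷ []) ++ reverse L
    ≡⟨ cong (_++ reverse L) (unfold-reverse c R) ⟨
  reverse (c ∷ R) ++ reverse L
    ≡⟨ reverse-++ L (c ∷ R) ⟨
  reverse (L ++ c ∷ R) ∎
  where
  open ≡-Reasoning
  L = innerLabels l
  R = innerLabels r
  c = suc (endLabel l + startLabel r)
  apex : endLabel (mirror r) + startLabel (mirror l) ≡ endLabel l + startLabel r
  apex = trans (cong₂ _+_ (endLabel-mirror r) (startLabel-mirror l)) (+-comm (startLabel r) (endLabel l))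

quiddity-mirror : ∀ t → quiddity (mirror t) ≡ reverse (quiddity t)
quiddity-mirror t = begin
  trim (mirror t) ∷ʳ endLabel (mirror t)
    ≡⟨ cong₂ _∷_ (startLabel-mirror t) (cong₂ _∷ʳ_ (innerLabels-mirror t) (endLabel-mirror t)) ⟩
  endLabel t ∷ reverse (innerLabels t) ∷ʳ startLabel t
    ≡⟨ cong (_∷ʳ startLabel t) (reverse-++ (innerLabels t) (endLabel t ∷ [])) ⟨
  reverse (innerLabels t ∷ʳ endLabel t) ∷ʳ startLabel t
    ≡⟨ unfold-reverse (startLabel t) (innerLabels t ∷ʳ endLabel t) ⟨
  reverse (quiddity t) ∎
  where open ≡-Reasoning

innerLabels-positive : ∀ t → All (0 <_) (innerLabels t)
innerLabels-positive leaf       = []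
innerLabels-positive (node l r) =
  All.++⁺ (innerLabels-positive l) (s≤s z≤n ∷ innerLabels-positive r)

quiddity-positive : ∀ l r → All (0 <_) (quiddity (node l r))
quiddity-positive l r =
  s≤s z≤n ∷ All.++⁺ (innerLabels-positive (node l r)) (s≤s z≤n ∷ [])

-- Consecutive values of a solution d.
State : Set
State = ℤ × ℤ

step : State → ℕ → State
step (x , y) c = y , + c ℤ.* y ℤ.- x

run : State → List ℕ → State
run = foldl step

negate : State → State
negate (x , y) = - x , - y

-- The solution on the inner vertices that takes the values p and q at the ends
-- of the base takes the value p + q at the apex of each triangle.
run-innerLabels : ∀ t p q →
  run (p , q ℤ.+ + startLabel t ℤ.* p) (innerLabels t) ≡ (p ℤ.+ + endLabel t ℤ.* q , q)
run-innerLabels leaf p q = cong₂ _,_ (lem₁ p q) (lem₂ q p)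
  where
  lem₁ : ∀ p q → p ≡ p ℤ.+ + 0 ℤ.* q
  lem₁ = solve-∀
  lem₂ : ∀ q p → q ℤ.+ + 0 ℤ.* p ≡ q
  lem₂ = solve-∀
run-innerLabels (node l r) p q = begin
  run (p , q ℤ.+ + suc a ℤ.* p) (L ++ c ∷ R)
    ≡⟨ foldl-++ step _ L (c ∷ R) ⟩
  run (run (p , q ℤ.+ + suc a ℤ.* p) L) (c ∷ R)
    ≡⟨ cong (λ s → run (run (p , s) L) (c ∷ R)) (lem₁ (+ a) p q) ⟩
  run (run (p , e ℤ.+ + a ℤ.* p) L) (c ∷ R)
    ≡⟨ cong (λ s → run s (c ∷ R)) (run-innerLabels l p e) ⟩
  run (e , + c ℤ.* e ℤ.- (p ℤ.+ + b ℤ.* e)) R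
    ≡⟨ cong (λ s → run (e , s) R) (lem₂ (+ a′) (+ b) p q) ⟩
  run (e , q ℤ.+ + a′ ℤ.* e) R
    ≡⟨ run-innerLabels r e q ⟩
  (e ℤ.+ + b′ ℤ.* q , q)
    ≡⟨ cong (_, q) (lem₃ (+ b′) p q) ⟩
  (p ℤ.+ + suc b′ ℤ.* q , q) ∎
  where
  open ≡-Reasoning
  L = innerLabels l
  R = innerLabels r
  a = startLabel l
  b = endLabel l
  a′ = startLabel r
  b′ = endLabel r
  c = suc (b + a′)
  e = p ℤ.+ q
  lem₁ : ∀ a p q → q ℤ.+ (+ 1 ℤ.+ a) ℤ.* p ≡ (p ℤ.+ q) ℤ.+ a ℤ.* p
  lem₁ = solve-∀
  lem₂ : ∀ a b p q → (+ 1 ℤ.+ (b ℤ.+ a)) ℤ.* (p ℤ.+ q) ℤ.- (p ℤ.+ b ℤ.* (p ℤ.+ q)) ≡ q ℤ.+ a ℤ.* (p ℤ.+ q)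
  lem₂ = solve-∀
  lem₃ : ∀ b p q → (p ℤ.+ q) ℤ.+ b ℤ.* q ≡ p ℤ.+ (+ 1 ℤ.+ b) ℤ.* q
  lem₃ = solve-∀

-- Here y is the value at the start vertex and x the value at the end vertex before the turn.
-- `run-innerLabels` with p = y and q = - x shows that the end vertex has the value - x after it.
run-quiddity : ∀ t s → run s (quiddity t) ≡ negate s
run-quiddity t (x , y) = begin
  run (y , + a ℤ.* y ℤ.- x) (innerLabels t ∷ʳ b)
    ≡⟨ foldl-∷ʳ step _ b (innerLabels t) ⟩
  step (run (y , + a ℤ.* y ℤ.- x) (innerLabels t)) b
    ≡⟨ cong (λ z → step (run (y , z) (innerLabels t)) b) (ℤ.+-comm (+ a ℤ.* y) (- x)) ⟩
  step (run (y , - x ℤ.+ + a ℤ.* y) (innerLabels t)) b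
    ≡⟨ cong (λ s → step s b) (run-innerLabels t y (- x)) ⟩
  (- x , + b ℤ.* - x ℤ.- (y ℤ.+ + b ℤ.* - x))
    ≡⟨ cong (- x ,_) (lem (+ b) x y) ⟩
  (- x , - y) ∎
  where
  open ≡-Reasoning
  a = startLabel t
  b = endLabel t
  lem : ∀ b x y → b ℤ.* - x ℤ.- (y ℤ.+ b ℤ.* - x) ≡ - y
  lem = solve-∀

-- Rotating and reversing the sequence

step-negate : ∀ s c → step (negate s) c ≡ negate (step s c)
step-negate (x , y) c = cong (- y ,_) (lem (+ c) x y)
  where
  lem : ∀ c x y → c ℤ.* - y ℤ.- - x ≡ - (c ℤ.* y ℤ.- x)
  lem = solve-∀

run-negate : ∀ s w → run (negate s) w ≡ negate (run s w)
run-negate s []      = refl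
run-negate s (c ∷ w) = trans (cong (λ u → run u w) (step-negate s c)) (run-negate (step s c) w)

-- The recurrence treats dᵢ₋₁ and dᵢ₊₁ alike, so swapping the state turns the direction of reading
-- around.
step-swap-step : ∀ s c → step (swap (step s c)) c ≡ swap s
step-swap-step (x , y) c = cong (y ,_) (lem (+ c) x y)
  where
  lem : ∀ c x y → c ℤ.* y ℤ.- (c ℤ.* y ℤ.- x) ≡ x
  lem = solve-∀

run-reverse-swap-run : ∀ w s → run (swap (run s w)) (reverse w) ≡ swap s
run-reverse-swap-run []      s = refl
run-reverse-swap-run (c ∷ w) s = begin
  run (swap (run (step s c) w)) (reverse (c ∷ w))
    ≡⟨ cong (run _) (unfold-reverse c w) ⟩
  run (swap (run (step s c) w)) (reverse w ∷ʳ c)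
    ≡⟨ foldl-∷ʳ step _ c (reverse w) ⟩
  step (run (swap (run (step s c) w)) (reverse w)) c
    ≡⟨ cong (λ u → step u c) (run-reverse-swap-run w (step s c)) ⟩
  step (swap (step s c)) c
    ≡⟨ step-swap-step s c ⟩
  swap s ∎
  where open ≡-Reasoning

run-surjective : ∀ w s → ∃[ u ] run u w ≡ s
run-surjective w s = swap (run (swap s) (reverse w)) , (begin
  run (swap (run (swap s) (reverse w))) w
    ≡⟨ cong (run _) (reverse-involutive w) ⟨
  run (swap (run (swap s) (reverse w))) (reverse (reverse w))
    ≡⟨ run-reverse-swap-run (reverse w) (swap s) ⟩
  s ∎)
  where open ≡-Reasoning

-- Write s as the state reached from some u by reading `v`. Reading `w` completes the turn from u,
-- and negation passes through the `v` that remains.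
run-rotate : ∀ v w → (∀ s → run s (v ++ w) ≡ negate s) → ∀ s → run s (w ++ v) ≡ negate s
run-rotate v w vw s with u , refl ← run-surjective v s = begin
  run (run u v) (w ++ v)       ≡⟨ foldl-++ step _ w v ⟩
  run (run (run u v) w) v      ≡⟨ cong (λ x → run x v) (foldl-++ step u v w) ⟨
  run (run u (v ++ w)) v       ≡⟨ cong (λ x → run x v) (vw u) ⟩
  run (negate u) v             ≡⟨ run-negate u v ⟩
  negate (run u v)             ∎
  where open ≡-Reasoning

-- The value 1 before the zero is recorded as well: the final state is then the swapped initial
-- state, which makes the condition invariant under reversal.
Vanishing : List ℕ → Set
Vanishing w = run (+ 0 , + 1) w ≡ (+ 1 , + 0)

-- The last step moves the second value into first place, where the negated state has 0; the other
-- component then gives x = 1.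
vanishing-trim : ∀ w a → (∀ s → run s (w ∷ʳ a) ≡ negate s) → Vanishing w
vanishing-trim w a eq with run (+ 0 , + 1) w | trans (sym (foldl-∷ʳ step (+ 0 , + 1) a w)) (eq (+ 0 , + 1))
... | x , y | e with refl ← cong proj₁ e = cong (_, + 0) (begin
  x                      ≡⟨ lem (+ a) x ⟩
  - (+ a ℤ.* + 0 ℤ.- x)  ≡⟨ cong (λ s → - (proj₂ s)) e ⟩
  + 1                    ∎)
  where
  open ≡-Reasoning
  lem : ∀ a x → x ≡ - (a ℤ.* + 0 ℤ.- x)
  lem = solve-∀

vanishing-reverse : ∀ w → Vanishing w → Vanishing (reverse w)
vanishing-reverse w eq =
  trans (cong (λ s → run (swap s) (reverse w)) (sym eq)) (run-reverse-swap-run w (+ 0 , + 1))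

-- Lower bounds for dᵢ₊₁ / dᵢ

infix 4 _Contains_

_Contains_ : List ℕ → WordSet → Set
w Contains X = ∃[ x ] x ∈ X × x IsSubstringOf w

contains-∷ : ∀ {X w} a → w Contains X → (a ∷ w) Contains X
contains-∷ a (x , x∈X , x⊑w) = x , x∈X , there x⊑w

contains-pair : ∀ {X a b w} → (a ∷ b ∷ []) ∈ X → (a ∷ b ∷ w) Contains X
contains-pair ab∈X = _ , ab∈X , here (refl ∷ refl ∷ [])

-- Class f consists of the letter suc f, except that the last class consists
-- of all letters from 6 on.

letter : Fin 6 → ℕ
letter f = suc (toℕ f)

class : ℕ → Fin 6
class c = fromℕ< (s≤s (m⊓n≤n (pred c) 5))

letter-class : ∀ c → letter (class (suc c)) ≡ suc (c ⊓ 5)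
letter-class c = cong suc (Fin.toℕ-fromℕ< (s≤s (m⊓n≤n c 5)))

letter-class-≤ : ∀ {c} → 0 < c → letter (class c) ≤ c
letter-class-≤ {suc c} _ = ≤-trans (≤-reflexive (letter-class c)) (s≤s (m⊓n≤m c 5))

letter-class-< : ∀ {c} → 0 < c → letter (class c) < 6 → letter (class c) ≡ c
letter-class-< {suc c} _ lt with ⊓-sel c 5
... | inj₁ eq = trans (letter-class c) (cong suc eq)
... | inj₂ eq = ⊥-elim (<-irrefl (trans (letter-class c) (cong suc eq)) lt)

-- p / q ≤ y / x  and  p′ / q′ ≤ s − q / p  give  p′ / q′ ≤ (c y − x) / y  for c ≥ s.
slope-step : ∀ q q′ {p p′ s c x y} → 0 < p → q′ * q + p * p′ ≤ p * (q′ * s) →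
             s ≤ c → p * x ≤ q * y → p′ * y + q′ * x ≤ q′ * (c * y)
slope-step q q′ {p} {p′} {s} {c} {x} {y} 0<p le s≤c px≤qy =
  *-cancelˡ-≤ p ⦃ >-nonZero 0<p ⦄ (begin
    p * (p′ * y + q′ * x)          ≡⟨ lem₁ p p′ q′ x y ⟩
    q′ * (p * x) + p * p′ * y      ≤⟨ +-monoˡ-≤ (p * p′ * y) (*-monoʳ-≤ q′ px≤qy) ⟩
    q′ * (q * y) + p * p′ * y      ≡⟨ lem₂ q′ q (p * p′) y ⟩
    (q′ * q + p * p′) * y          ≤⟨ *-monoˡ-≤ y le ⟩
    p * (q′ * s) * y               ≤⟨ *-monoˡ-≤ y (*-monoʳ-≤ p (*-monoʳ-≤ q′ s≤c)) ⟩
    p * (q′ * c) * y               ≡⟨ lem₃ p q′ c y ⟩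
    p * (q′ * (c * y))             ∎)
  where
  open ≤-Reasoning
  lem₁ : ∀ p p′ q′ x y → p * (p′ * y + q′ * x) ≡ q′ * (p * x) + p * p′ * y
  lem₁ = ℕ-solve-∀
  lem₂ : ∀ q′ q m y → q′ * (q * y) + m * y ≡ (q′ * q + m) * y
  lem₂ = ℕ-solve-∀
  lem₃ : ∀ p q′ c y → p * (q′ * c) * y ≡ p * (q′ * (c * y))
  lem₃ = ℕ-solve-∀

positive-by-slope : ∀ q {p x y} → 0 < p → 0 < x → p * x ≤ q * y → 0 < y
positive-by-slope q {y = suc y} _ _ _ = s≤s z≤n
positive-by-slope q {p} {x} {zero} 0<p 0<x le = ⊥-elim (<-irrefl refl
  (<-≤-trans (*-mono-≤ 0<p 0<x) (≤-trans le (≤-reflexive (*-zeroʳ q)))))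

step-ℕ : ∀ {x y} c → x ≤ c * y → step (+ x , + y) c ≡ (+ y , + (c * y ∸ x))
step-ℕ {x} {y} c x≤cy = cong (+ y ,_) (begin
  + c ℤ.* + y ℤ.- + x   ≡⟨ cong (ℤ._- + x) (ℤ.pos-* c y) ⟨
  + (c * y) ℤ.- + x     ≡⟨ ℤ.m-n≡m⊖n (c * y) x ⟩
  c * y ℤ.⊖ x           ≡⟨ ℤ.⊖-≥ x≤cy ⟩
  + (c * y ∸ x)         ∎)
  where open ≡-Reasoning

-- The entry of class f is a lower bound, as a fraction, for dᵢ₊₁ / dᵢ after a
-- letter cᵢ of class f.
Slopes : Set
Slopes = Vec (ℕ × ℕ) 6

module _ (t : Slopes) where
  num den : Fin 6 → ℕ
  num f = proj₁ (lookup t f)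
  den f = proj₂ (lookup t f)

  -- The clause stepwise says  num g / den g ≤ letter g − den f / num f.
  record Certifies (O : WordSet) : Set where
    constructor certifies
    field
      num-positive : ∀ f → 0 < num f
      den-positive : ∀ f → 0 < den f
      initial      : ∀ f → num f ≤ den f * letter f
      stepwise     : ∀ f g → (letter f ∷ letter g ∷ []) ∈ O ⊎
                     den g * den f + num f * num g ≤ num f * (den g * letter g)
      small        : All (All (_< 6)) O

  certifies? : ∀ O → Dec (Certifies O)
  certifies? O
    with Fin.all? (λ f → 0 <? num f) ×-dec Fin.all? (λ f → 0 <? den f)
         ×-dec Fin.all? (λ f → num f ≤? den f * letter f)
         ×-dec Fin.all? (λ f → Fin.all? λ g → ((letter f ∷ letter g ∷ []) ∈? O) ⊎-dec
                 (den g * den f + num f * num g ≤? num f * (den g * letter g)))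
         ×-dec All.all? (All.all? (_<? 6)) O
  ... | yes (a , b , c , d , e) = yes (certifies a b c d e)
  ... | no ¬p = no λ (certifies a b c d e) → ¬p (a , b , c , d , e)

  module _ {O} (cert : Certifies O) where
    open Certifies cert

    -- Letters below 6 are alone in their classes, so a pair of representatives in `O` is the pair
    -- of actual letters.
    small-class : ∀ {a b} → 0 < a → 0 < b →
                  (letter (class a) ∷ letter (class b) ∷ []) ∈ O → (a ∷ b ∷ []) ∈ O
    small-class 0<a 0<b m with a<6 ∷ b<6 ∷ [] ← All.lookup small m =
      subst₂ (λ a b → (a ∷ b ∷ []) ∈ O) (letter-class-< 0<a a<6) (letter-class-< 0<b b<6) m

    -- Induction along the word: (x , y) is the state after the letter `a`, and the invariant is the
    -- lower bound on y / x for the class of `a`. The next letter either completes a pair of `O` or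
    -- inherits a bound.
    contains-or-positive : ∀ a w x y → 0 < a → All (0 <_) w → 0 < x →
      num (class a) * x ≤ den (class a) * y →
      (a ∷ w) Contains O ⊎ ∃[ s ] run (+ x , + y) w ≡ s × + 0 ℤ.< proj₂ s
    contains-or-positive a [] x y _ _ 0<x le =
      inj₂ (_ , refl , ℤ.+<+ (positive-by-slope (den (class a)) (num-positive (class a)) 0<x le))
    contains-or-positive a (c ∷ w) x y 0<a (0<c ∷ 0<w) 0<x le with stepwise (class a) (class c)
    ... | inj₁ ac∈O = inj₁ (contains-pair (small-class 0<a 0<c ac∈O))
    ... | inj₂ st with contains-or-positive c w y (c * y ∸ x) 0<c 0<w 0<y le′
      where
      f = class a
      g = class c
      0<y : 0 < y
      0<y = positive-by-slope (den f) (num-positive f) 0<x le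
      le″ : num g * y + den g * x ≤ den g * (c * y)
      le″ = slope-step (den f) (den g) (num-positive f) st (letter-class-≤ 0<c) le
      le′ : num g * y ≤ den g * (c * y ∸ x)
      le′ = ≤-trans (m+n≤o⇒m≤o∸n (num g * y) le″) (≤-reflexive (sym (*-distribˡ-∸ (den g) (c * y) x)))
    ...   | inj₁ found = inj₁ (contains-∷ a found)
    ...   | inj₂ (s , eq , 0<s) = inj₂ (s , trans (cong (λ s → run s w) (step-ℕ c x≤cy)) eq , 0<s)
      where
      g = class c
      -- Hence `c * y ∸ x` is not truncated and agrees with the integer step.
      x≤cy : x ≤ c * y
      x≤cy = *-cancelˡ-≤ (den g) ⦃ >-nonZero (den-positive g) ⦄
               (≤-trans (m≤n+m (den g * x) (num g * y))
                 (slope-step (den (class a)) (den g) (num-positive (class a)) st (letter-class-≤ 0<c) le))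

    -- From (0 , 1) the first letter c leads to (1 , c), whose ratio `initial` bounds. Without a
    -- pair of `O` the last value would stay positive instead of vanishing. The empty word is
    -- absurd, since (0 , 1) is not (1 , 0).
    certified⇒contains : ∀ w → All (0 <_) w → Vanishing w → w Contains O
    certified⇒contains (c ∷ w) (0<c ∷ 0<w) van
      with contains-or-positive c w 1 c 0<c 0<w (s≤s z≤n)
             (≤-trans (≤-reflexive (*-identityʳ (num (class c))))
               (≤-trans (initial (class c)) (*-monoʳ-≤ (den (class c)) (letter-class-≤ 0<c))))
    ... | inj₁ found = found
    ... | inj₂ (s , eq , 0<s) = ⊥-elim (ℤ.<-irrefl (cong proj₂ (sym van′)) 0<s)
      where
      van′ : s ≡ (+ 1 , + 0)
      van′ = trans (sym eq) (trans (cong (λ s → run s w) (sym lem)) van)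
        where
        lem : step (+ 0 , + 1) c ≡ (+ 1 , + c)
        lem = trans (step-ℕ {0} {1} c z≤n) (cong (λ m → + 1 , + m) (*-identityʳ c))

-- The tree of a triangulated polygon

largest : ∀ {n} {Q : Fin n → Set} → U.Decidable Q → ∀ {i} → Q i →
          ∃[ m ] Q m × (∀ {z} → m Fin.< z → ¬ Q z)
largest {Q = Q} Q? {i} = go (>-wellFounded i)
  where
  go : ∀ {i} → Acc Fin._>_ i → Q i → ∃[ m ] Q m × (∀ {z} → m Fin.< z → ¬ Q z)
  go {i} (acc rec) qi with Fin.any? (λ z → (i Fin.<? z) ×-dec Q? z)
  ... | yes (z , i<z , qz) = go (rec i<z) qz
  ... | no  none           = i , qi , λ i<z qz → none (_ , i<z , qz)

iterate-++ : ∀ i m p → iterate suc i (m + p) ≡ iterate suc i m ++ iterate suc (i + m) p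
iterate-++ i zero    p = cong (λ s → iterate suc s p) (sym (+-identityʳ i))
iterate-++ i (suc m) p = cong (i ∷_) (trans (iterate-++ (suc i) m p)
  (cong (λ s → iterate suc (suc i) m ++ iterate suc s p) (sym (+-suc i m))))

map-toℕ-allFin : ∀ n → map toℕ (allFin n) ≡ iterate suc 0 n
map-toℕ-allFin n = trans (map-tabulate id toℕ) (go n 0)
  where
  go : ∀ n m → tabulate {n = n} (λ a → m + toℕ a) ≡ iterate suc m n
  go zero    m = refl
  go (suc n) m = cong₂ _∷_ (+-identityʳ m) (trans (tabulate-cong (λ a → +-suc m (toℕ a))) (go n (suc m)))

module Polygon (P : TriangulatedPolygon) where
  open TriangulatedPolygon P

  -- Sides cross nothing: no vertex lies strictly between neighbours, before the first vertex or
  -- beyond the last.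
  joined-non-crossing : ∀ {i j k l} → Joined i j → Joined k l → ¬ Crosses i j k l
  joined-non-crossing (inj₁ (inj₁ eq)) _ (i<k , k<j , _) =
    <-irrefl refl (<-≤-trans k<j (≤-trans (≤-reflexive (sym eq)) i<k))
  joined-non-crossing {l = l} (inj₁ (inj₂ (_ , eq))) _ (_ , _ , j<l) =
    <-irrefl refl (<-≤-trans (Fin.toℕ<n l) (≤-trans (≤-reflexive (sym eq)) j<l))
  joined-non-crossing (inj₂ _) (inj₁ (inj₁ eq)) (_ , k<j , j<l) =
    <-irrefl refl (<-≤-trans j<l (≤-trans (≤-reflexive (sym eq)) k<j))
  joined-non-crossing (inj₂ _) (inj₁ (inj₂ (eq , _))) (i<k , _ , _) =
    n≮0 (<-≤-trans i<k (≤-reflexive eq))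
  joined-non-crossing (inj₂ d) (inj₂ e) = non-crossing d e

  -- A path that always moves to the farthest joined vertex not beyond `j` has no chords, and
  -- `consecutive` records this. Such a path can bound a piece.
  record GreedyPath (x j : Fin n) : Set where
    field
      len         : ℕ
      corner      : Fin (suc len) → Fin n
      start       : corner zero ≡ x
      end         : corner (fromℕ len) ≡ j
      increasing  : ∀ {a b} → a Fin.< b → corner a Fin.< corner b
      bounded     : ∀ a → corner a Fin.≤ j
      consecutive : ∀ {a b} → a Fin.< b → Joined (corner a) (corner b) ⇔ suc (toℕ a) ≡ toℕ b

  next : ∀ {x j : Fin n} → x Fin.< j → ∃[ y ] suc (toℕ x) ≡ toℕ y
  next {j = j} x<j = fromℕ< (≤-<-trans x<j (Fin.toℕ<n j)) , sym (Fin.toℕ-fromℕ< _)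

  greedyPath : ∀ x j → x Fin.≤ j → GreedyPath x j
  greedyPath x j = go (>-wellFounded x)
    where
    go : ∀ {x} → Acc Fin._>_ x → x Fin.≤ j → GreedyPath x j
    go {x} (acc rec) x≤j with Fin.<-cmp x j
    ... | tri> _ _ j<x = ⊥-elim (<-irrefl refl (<-≤-trans j<x x≤j))
    ... | tri≈ _ refl _ = record
      { len         = 0
      ; corner      = λ _ → x
      ; start       = refl
      ; end         = refl
      ; increasing  = λ { {zero} {zero} () }
      ; bounded     = λ _ → ≤-refl
      ; consecutive = λ { {zero} {zero} () }
      }
    ... | tri< x<j _ _ with s , x⋖s ← next x<j
      -- The successor of x is joined to it by a side, so there is a farthest candidate.
      with y , (xy , x<y , y≤j) , max ←
        largest (λ z → joined? x z ×-dec (x Fin.<? z) ×-dec (z Fin.≤? j))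
                (inj₁ (inj₁ x⋖s) , ≤-reflexive x⋖s , ≤-trans (≤-reflexive (sym x⋖s)) x<j)
      = record
      { len         = suc R.len
      ; corner      = corner′
      ; start       = refl
      ; end         = R.end
      ; increasing  = increasing′
      ; bounded     = λ { zero → x≤j ; (suc a) → R.bounded a }
      ; consecutive = consecutive′
      }
      where
      module R = GreedyPath (go (rec x<y) y≤j)
      corner′ = x Vector.∷ R.corner
      y<corner : ∀ b → y Fin.< R.corner (suc b)
      y<corner b = subst (Fin._< R.corner (suc b)) R.start (R.increasing (s≤s z≤n))
      increasing′ : ∀ {a b} → a Fin.< b → corner′ a Fin.< corner′ b
      increasing′ {zero}  {suc zero}    _   = subst (x Fin.<_) (sym R.start) x<y
      increasing′ {zero}  {suc (suc b)} _   = <-trans x<y (y<corner b)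
      increasing′ {suc a} {suc b}       a<b = R.increasing (s≤s⁻¹ a<b)
      consecutive′ : ∀ {a b} → a Fin.< b → Joined (corner′ a) (corner′ b) ⇔ suc (toℕ a) ≡ toℕ b
      consecutive′ {zero}  {suc zero}    _   = mk⇔ (λ _ → refl) (λ _ → subst (Joined x) (sym R.start) xy)
      consecutive′ {zero}  {suc (suc b)} _   = mk⇔
        (λ xz → ⊥-elim (max (y<corner b) (xz , <-trans x<y (y<corner b) , R.bounded (suc b)))) (λ ())
      consecutive′ {suc a} {suc b}       a<b = mk⇔ (cong suc ∘ to) (from ∘ suc-injective)
        where open Equivalence (R.consecutive (s≤s⁻¹ a<b))

  -- The greedy path from i that avoids the edge ij closes up to a piece, which
  -- is therefore a triangle.
  apex : ∀ {i j} → Joined i j → suc (toℕ i) < toℕ j →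
         ∃[ k ] i Fin.< k × k Fin.< j × Joined i k × Joined k j
  apex {i} {j} ij gap with s , i⋖s ← next {i} {j} (<-trans (n<1+n _) gap)
    with y , (iy , i<y , y<j) , max ←
      largest (λ z → joined? i z ×-dec (i Fin.<? z) ×-dec (z Fin.<? j))
              (inj₁ (inj₁ i⋖s) , ≤-reflexive i⋖s , ≤-trans (≤-reflexive (cong suc (sym i⋖s))) gap)
    = y , i<y , y<j , iy , yj
    where
    open GreedyPath (greedyPath y j (<⇒≤ y<j))
    corner′ = i Vector.∷ corner
    y≤corner : ∀ b → y Fin.≤ corner b
    y≤corner zero    = ≤-reflexive (cong toℕ (sym start))
    y≤corner (suc b) = <⇒≤ (subst (Fin._< corner (suc b)) start (increasing (s≤s z≤n)))
    increasing′ : ∀ {a b} → a Fin.< b → corner′ a Fin.< corner′ b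
    increasing′ {zero}  {suc b} _   = <-≤-trans i<y (y≤corner b)
    increasing′ {suc a} {suc b} a<b = increasing (s≤s⁻¹ a<b)
    last-or-before : ∀ b → toℕ b ≡ len × corner b ≡ j ⊎ corner b Fin.< j
    last-or-before b with Fin.<-cmp b (fromℕ len)
    ... | tri< b<l _ _  = inj₂ (subst (corner b Fin.<_) end (increasing b<l))
    ... | tri≈ _ refl _ = inj₁ (Fin.toℕ-fromℕ len , end)
    ... | tri> _ _ l<b  = ⊥-elim (<-irrefl (Fin.toℕ-fromℕ len) (<-≤-trans l<b (s≤s⁻¹ (Fin.toℕ<n b))))
    only : ∀ {a b} → a Fin.< b → Joined (corner′ a) (corner′ b) ⇔ Side a b
    only {zero} {suc zero} _ = mk⇔ (λ _ → inj₁ refl) (λ _ → subst (Joined i) (sym start) iy)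
    only {zero} {suc (suc b)} _ = mk⇔ to from
      where
      y<corner : y Fin.< corner (suc b)
      y<corner = subst (Fin._< corner (suc b)) start (increasing (s≤s z≤n))
      to : Joined i (corner (suc b)) → Side zero (suc (suc b))
      to iz with last-or-before (suc b)
      ... | inj₁ (eq , _) = inj₂ (refl , cong (λ m → suc (suc m)) eq)
      ... | inj₂ z<j      = ⊥-elim (max y<corner (iz , <-trans i<y y<corner , z<j))
      from : Side zero (suc (suc b)) → Joined i (corner (suc b))
      from (inj₂ (_ , eq)) = subst (Joined i) (trans (sym end) (cong corner (Fin.toℕ-injective
        (trans (Fin.toℕ-fromℕ len) (sym (suc-injective (suc-injective eq))))))) ij
    only {suc a} {suc b} a<b = mk⇔ (inj₁ ∘ cong suc ∘ to) λ { (inj₁ eq) → from (suc-injective eq) }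
      where open Equivalence (consecutive (s≤s⁻¹ a<b))
    piece : Piece Joined (suc (suc len))
    piece = record { corner = corner′ ; increasing = increasing′ ; sides-only = only }
    0<len : 0 < len
    0<len = n≢0⇒n>0 λ len≡0 → <-irrefl (cong toℕ (trans (sym start) (trans
      (cong corner (Fin.toℕ-injective (sym (trans (Fin.toℕ-fromℕ len) len≡0)))) end))) y<j
    -- The piece consists of i and the len + 1 corners of the path; being a triangle, it leaves the
    -- path the single edge from y to j.
    len≡1 : len ≡ 1
    len≡1 = suc-injective (suc-injective (divided-into-triangles (s≤s (s≤s 0<len)) piece))
    yj : Joined y j
    yj = subst₂ Joined start end (Equivalence.from
      (consecutive {zero} {fromℕ len} (≤-trans 0<len (≤-reflexive (sym (Fin.toℕ-fromℕ len)))))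
      (sym (trans (Fin.toℕ-fromℕ len) len≡1)))

  -- A dissection of the sub-polygon with vertices i, i + 1, …, j.
  data Dissection : Fin n → Fin n → Set where
    side     : ∀ {i j} → suc (toℕ i) ≡ toℕ j → Dissection i j
    triangle : ∀ {i k j} → Joined i j → Dissection i k → Dissection k j → Dissection i j

  dissect : ∀ {i j} → i Fin.< j → Joined i j → Dissection i j
  dissect = go (<-wellFounded _)
    where
    go : ∀ {i j} → Acc _<_ (toℕ j ∸ toℕ i) → i Fin.< j → Joined i j → Dissection i j
    go (acc rec) i<j ij with m≤n⇒m<n∨m≡n i<j
    ... | inj₂ i⋖j = side i⋖j
    ... | inj₁ gap with k , i<k , k<j , ik , kj ← apex ij gap =
      triangle ij (go (rec (∸-monoˡ-< k<j (<⇒≤ i<k))) i<k ik)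
                  (go (rec (∸-monoʳ-< i<k (<⇒≤ k<j))) k<j kj)

  shape : ∀ {i j} → Dissection i j → Tree
  shape (side _)         = leaf
  shape (triangle _ l r) = node (shape l) (shape r)

  pieces : ∀ {i j} → Dissection i j → List (Fin n × Fin n × Fin n)
  pieces (side _)                       = []
  pieces (triangle {i} {k} {j} _ l r) = (i , k , j) ∷ pieces l ++ pieces r

  inner : ∀ {i j} → Dissection i j → List (Fin n)
  inner (side _)                 = []
  inner (triangle {k = k} _ l r) = inner l ++ k ∷ inner r

  dissection-< : ∀ {i j} → Dissection i j → i Fin.< j
  dissection-< (side i⋖j)       = ≤-reflexive i⋖j
  dissection-< (triangle _ l r) = <-trans (dissection-< l) (dissection-< r)

  dissection-joined : ∀ {i j} → Dissection i j → Joined i j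
  dissection-joined (side i⋖j)        = inj₁ (inj₁ i⋖j)
  dissection-joined (triangle ij _ _) = ij

  Within : Fin n → Fin n → Fin n × Fin n × Fin n → Set
  Within i j t@(a , b , c) = Triangle t × i Fin.≤ a × c Fin.≤ j

  pieces-within : ∀ {i j} (d : Dissection i j) → All (Within i j) (pieces d)
  pieces-within (side _) = []
  pieces-within (triangle ij l r) =
    ((i<k , k<j , dissection-joined l , dissection-joined r , ij) , ≤-refl , ≤-refl) ∷
    All.++⁺ (All.map (λ (t , i≤a , c≤k) → t , i≤a , ≤-trans c≤k (<⇒≤ k<j)) (pieces-within l))
            (All.map (λ (t , k≤a , c≤j) → t , ≤-trans (<⇒≤ i<k) k≤a , c≤j) (pieces-within r))
    where
    i<k = dissection-< l
    k<j = dissection-< r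

  -- A triangle on neither side of k has a < k < c. As ac crosses neither ik nor kj, a = i and c =
  -- j. Then b = k, since otherwise bc would cross ik or ab would cross kj.
  within-pieces : ∀ {i j} (d : Dissection i j) {t} → Within i j t → t ∈ pieces d
  within-pieces (side i⋖j) ((a<b , b<c , _) , i≤a , c≤j) = ⊥-elim (<-irrefl refl
    (<-≤-trans (≤-<-trans i≤a a<b) (s≤s⁻¹ (≤-trans (<-≤-trans b<c c≤j) (≤-reflexive (sym i⋖j))))))
  within-pieces (triangle {i} {k} {j} ij l r) {a , b , c} (t@(a<b , b<c , ab , bc , ac) , i≤a , c≤j)
    with toℕ c ℕ.≤? toℕ k | toℕ k ℕ.≤? toℕ a
  ... | yes c≤k | _ = there (∈-++⁺ˡ (within-pieces l (t , i≤a , c≤k)))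
  ... | no  _   | yes k≤a = there (∈-++⁺ʳ (pieces l) (within-pieces r (t , k≤a , c≤j)))
  ... | no  c≰k | no k≰a with m≤n⇒m<n∨m≡n i≤a | m≤n⇒m<n∨m≡n c≤j
  ...   | inj₁ i<a | _ =
    ⊥-elim (joined-non-crossing (dissection-joined l) ac (i<a , ≰⇒> k≰a , ≰⇒> c≰k))
  ...   | inj₂ _   | inj₁ c<j =
    ⊥-elim (joined-non-crossing ac (dissection-joined r) (≰⇒> k≰a , ≰⇒> c≰k , c<j))
  ...   | inj₂ i≡a | inj₂ c≡j with Fin.toℕ-injective i≡a | Fin.toℕ-injective c≡j | Fin.<-cmp b k
  ...     | refl | refl | tri< b<k _ _ =
    ⊥-elim (joined-non-crossing (dissection-joined l) bc (a<b , b<k , ≰⇒> c≰k))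
  ...     | refl | refl | tri≈ _ refl _ = here refl
  ...     | refl | refl | tri> _ _ k<b =
    ⊥-elim (joined-non-crossing ab (dissection-joined r) (≰⇒> k≰a , k<b , b<c))

  pieces-unique : ∀ {i j} (d : Dissection i j) → Unique (pieces d)
  pieces-unique (side _) = []
  pieces-unique (triangle _ l r) =
    All.++⁺
      (All.map (λ { (_ , _ , c≤k) refl → <-irrefl refl (<-≤-trans (dissection-< r) c≤k) })
        (pieces-within l))
      (All.map (λ { (_ , k≤a , _) refl → <-irrefl refl (<-≤-trans (dissection-< l) k≤a) })
        (pieces-within r))
    ∷ Unique.++⁺ (pieces-unique l) (pieces-unique r) λ (∈l , ∈r) →
        let (a<b , b<c , _) , _ , c≤k = All.lookup (pieces-within l) ∈l
            _ , k≤a , _ = All.lookup (pieces-within r) ∈r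
        in <-irrefl refl (<-≤-trans (<-trans a<b b<c) (≤-trans c≤k k≤a))

  count : ∀ {i j} → Dissection i j → Fin n → ℕ
  count d v = length (filter (incident? v) (pieces d))

  count-outside : ∀ {i j} (d : Dissection i j) {v} → v Fin.< i ⊎ j Fin.< v → count d v ≡ 0
  count-outside d {v} out = cong length (filter-none (incident? v) (All.map (miss out) (pieces-within d)))
    where
    miss : ∀ {i j t} → v Fin.< i ⊎ j Fin.< v → Within i j t → ¬ Incident v t
    miss (inj₁ v<i) ((a<b , b<c , _) , i≤a , _) = λ where
      (inj₁ refl)        → <-irrefl refl (<-≤-trans v<i i≤a)
      (inj₂ (inj₁ refl)) → <-asym (<-≤-trans v<i i≤a) a<b
      (inj₂ (inj₂ refl)) → <-asym (<-≤-trans v<i i≤a) (<-trans a<b b<c)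
    miss (inj₂ j<v) ((a<b , b<c , _) , _ , c≤j) = λ where
      (inj₁ refl)        → <-asym (≤-<-trans c≤j j<v) (<-trans a<b b<c)
      (inj₂ (inj₁ refl)) → <-asym (≤-<-trans c≤j j<v) b<c
      (inj₂ (inj₂ refl)) → <-irrefl refl (≤-<-trans c≤j j<v)

  length-filter-++ : ∀ v ts us → length (filter (incident? v) (ts ++ us)) ≡
                     length (filter (incident? v) ts) + length (filter (incident? v) us)
  length-filter-++ v ts us = trans (cong length (filter-++ (incident? v) ts us))
                                   (length-++ (filter (incident? v) ts))

  module _ {i k j} (ij : Joined i j) (l : Dissection i k) (r : Dissection k j) where
    count-corner : ∀ {v} → Incident v (i , k , j) → count (triangle ij l r) v ≡ suc (count l v + count r v)
    count-corner {v} inc = trans (cong length (filter-accept (incident? v) inc))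
                                 (cong suc (length-filter-++ v (pieces l) (pieces r)))

    count-other : ∀ {v} → ¬ Incident v (i , k , j) → count (triangle ij l r) v ≡ count l v + count r v
    count-other {v} ¬inc = trans (cong length (filter-reject (incident? v) ¬inc))
                                 (length-filter-++ v (pieces l) (pieces r))

  count-start : ∀ {i j} (d : Dissection i j) → count d i ≡ startLabel (shape d)
  count-start (side _) = refl
  count-start (triangle ij l r) = trans (count-corner ij l r (inj₁ refl)) (cong suc
    (trans (cong₂ _+_ (count-start l) (count-outside r (inj₁ (dissection-< l)))) (+-identityʳ _)))

  count-end : ∀ {i j} (d : Dissection i j) → count d j ≡ endLabel (shape d)
  count-end (side _) = refl
  count-end (triangle ij l r) = trans (count-corner ij l r (inj₂ (inj₂ refl))) (cong suc
    (cong₂ _+_ (count-outside l (inj₂ (dissection-< r))) (count-end r)))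

  inner-between : ∀ {i j} (d : Dissection i j) → All (λ v → i Fin.< v × v Fin.< j) (inner d)
  inner-between (side _) = []
  inner-between (triangle _ l r) =
    All.++⁺ (All.map (λ (i<v , v<k) → i<v , <-trans v<k (dissection-< r)) (inner-between l))
      ((dissection-< l , dissection-< r) ∷
       All.map (λ (k<v , v<j) → <-trans (dissection-< l) k<v , v<j) (inner-between r))

  count-inner : ∀ {i j} (d : Dissection i j) → map (count d) (inner d) ≡ innerLabels (shape d)
  count-inner (side _) = refl
  count-inner d@(triangle {i} {k} {j} ij l r) = begin
    map (count d) (inner l ++ k ∷ inner r)
      ≡⟨ map-++ (count d) (inner l) (k ∷ inner r) ⟩
    map (count d) (inner l) ++ count d k ∷ map (count d) (inner r)
      ≡⟨ cong₂ _++_ (map-cong-local (All.map left (inner-between l)))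
           (cong₂ _∷_ (count-corner ij l r (inj₂ (inj₁ refl)))
                      (map-cong-local (All.map right (inner-between r)))) ⟩
    map (count l) (inner l) ++ suc (count l k + count r k) ∷ map (count r) (inner r)
      ≡⟨ cong₂ _++_ (count-inner l)
           (cong₂ _∷_ (cong suc (cong₂ _+_ (count-end l) (count-start r))) (count-inner r)) ⟩
    innerLabels (shape l) ++ suc (endLabel (shape l) + startLabel (shape r)) ∷ innerLabels (shape r) ∎
    where
    open ≡-Reasoning
    left : ∀ {v} → i Fin.< v × v Fin.< k → count d v ≡ count l v
    left {v} (i<v , v<k) = trans (count-other ij l r
      (λ { (inj₁ refl) → <-irrefl refl i<v
         ; (inj₂ (inj₁ refl)) → <-irrefl refl v<k
         ; (inj₂ (inj₂ refl)) → <-asym v<k (dissection-< r) }))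
      (trans (cong (λ m → count l v + m) (count-outside r (inj₁ v<k))) (+-identityʳ _))
    right : ∀ {v} → k Fin.< v × v Fin.< j → count d v ≡ count r v
    right {v} (k<v , v<j) = trans (count-other ij l r
      (λ { (inj₁ refl) → <-asym k<v (dissection-< l)
         ; (inj₂ (inj₁ refl)) → <-irrefl refl k<v
         ; (inj₂ (inj₂ refl)) → <-irrefl refl v<j }))
      (cong (_+ count r v) (count-outside l (inj₂ k<v)))

  -- The end j is left out of the list, so that the lists of the two halves concatenate without
  -- repeating k.
  inner-consecutive : ∀ {i j} (d : Dissection i j) →
    ∃[ m ] toℕ i + m ≡ toℕ j × map toℕ (i ∷ inner d) ≡ iterate suc (toℕ i) m
  inner-consecutive {i} (side i⋖j) = 1 , trans (+-comm (toℕ i) 1) i⋖j , refl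
  inner-consecutive {i} (triangle {k = k} _ l r)
    with m , i+m≡k , eqˡ ← inner-consecutive l | p , k+p≡j , eqʳ ← inner-consecutive r =
    m + p ,
    trans (sym (+-assoc (toℕ i) m p)) (trans (cong (_+ p) i+m≡k) k+p≡j) ,
    (begin
      map toℕ ((i ∷ inner l) ++ k ∷ inner r)
        ≡⟨ map-++ toℕ (i ∷ inner l) (k ∷ inner r) ⟩
      map toℕ (i ∷ inner l) ++ map toℕ (k ∷ inner r)
        ≡⟨ cong₂ _++_ eqˡ eqʳ ⟩
      iterate suc (toℕ i) m ++ iterate suc (toℕ k) p
        ≡⟨ cong (λ s → iterate suc (toℕ i) m ++ iterate suc s p) i+m≡k ⟨
      iterate suc (toℕ i) m ++ iterate suc (toℕ i + m) p
        ≡⟨ iterate-++ (toℕ i) m p ⟨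
      iterate suc (toℕ i) (m + p) ∎)
    where open ≡-Reasoning

  module _ {first last : Fin n} (first≡0 : toℕ first ≡ 0) (last≡n-1 : suc (toℕ last) ≡ n)
           (d : Dissection first last) where

    allFin-inner : allFin n ≡ first ∷ inner d ∷ʳ last
    allFin-inner with m , 0+m≡last , eq ← inner-consecutive d =
      map-injective Fin.toℕ-injective (begin
        map toℕ (allFin n)
          ≡⟨ map-toℕ-allFin n ⟩
        iterate suc 0 n
          ≡⟨ cong (iterate suc 0) (trans (+-comm m 1) (trans (cong suc m≡last) last≡n-1)) ⟨
        iterate suc 0 (m + 1)
          ≡⟨ iterate-++ 0 m 1 ⟩
        iterate suc 0 m ++ m ∷ []
          ≡⟨ cong₂ _++_ (trans eq (cong (λ s → iterate suc s m) first≡0)) (cong (_∷ []) (sym m≡last)) ⟨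
        map toℕ (first ∷ inner d) ++ toℕ last ∷ []
          ≡⟨ map-++ toℕ (first ∷ inner d) (last ∷ []) ⟨
        map toℕ (first ∷ inner d ∷ʳ last) ∎)
      where
      open ≡-Reasoning
      m≡last : m ≡ toℕ last
      m≡last = trans (cong (_+ m) (sym first≡0)) 0+m≡last

    -- Both lists are free of repetitions and have the same members, as every triangle lies between
    -- the first and the last vertex.
    triangles↭pieces : triangles ↭ pieces d
    triangles↭pieces = ∼bag⇒↭ (unique∧set⇒bag
      (Unique.filter⁺ triangle? (Unique.cartesianProduct⁺ (Unique.allFin⁺ n)
        (Unique.cartesianProduct⁺ (Unique.allFin⁺ n) (Unique.allFin⁺ n))))
      (pieces-unique d)
      (mk⇔ (λ t∈ → within-pieces d (proj₂ (∈-filter⁻ triangle? {xs = triples} t∈) ,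
                   ≤-trans (≤-reflexive first≡0) z≤n ,
                   s≤s⁻¹ (≤-trans (Fin.toℕ<n _) (≤-reflexive (sym last≡n-1)))))
           (λ t∈ → ∈-filter⁺ triangle? (∈-cartesianProduct⁺ (∈-allFin _)
                     (∈-cartesianProduct⁺ (∈-allFin _) (∈-allFin _)))
                     (proj₁ (All.lookup (pieces-within d) t∈)))))
      where
      triples = cartesianProduct (allFin n) (cartesianProduct (allFin n) (allFin n))

    label≡count : ∀ v → label v ≡ count d v
    label≡count v = ↭-length (filter-↭ (incident? v) triangles↭pieces)

    labels≡quiddity : labels ≡ quiddity (shape d)
    labels≡quiddity = begin
      tabulate label                       ≡⟨ map-tabulate id label ⟨
      map label (allFin n)                 ≡⟨ map-cong label≡count (allFin n) ⟩
      map (count d) (allFin n)             ≡⟨ cong (map (count d)) allFin-inner ⟩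
      count d first ∷ map (count d) (inner d ∷ʳ last)
        ≡⟨ cong (count d first ∷_) (map-++ (count d) (inner d) (last ∷ [])) ⟩
      count d first ∷ map (count d) (inner d) ∷ʳ count d last
        ≡⟨ cong₂ _∷_ (count-start d) (cong₂ _∷ʳ_ (count-inner d) (count-end d)) ⟩
      quiddity (shape d) ∎
      where open ≡-Reasoning

-- The triangulated polygon of a tree

size : Tree → ℕ
size leaf       = 1
size (node l r) = size l + size r

0<size : ∀ t → 0 < size t
0<size leaf       = s≤s z≤n
0<size (node l r) = ≤-trans (0<size l) (m≤m+n (size l) (size r))

-- The sides and diagonals of the polygon with vertices o, o + 1, …, o + size t
-- that t dissects, the base of t being the side from o to o + size t.
Edge : Tree → ℕ → ℕ → ℕ → Set
Edge leaf       o a b = a ≡ o × b ≡ o + 1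
Edge (node l r) o a b =
  (a ≡ o × b ≡ o + size (node l r)) ⊎ Edge l o a b ⊎ Edge r (o + size l) a b

edge? : ∀ t o → Decidable (Edge t o)
edge? leaf       o a b = (a ℕ.≟ o) ×-dec (b ℕ.≟ o + 1)
edge? (node l r) o a b = ((a ℕ.≟ o) ×-dec (b ℕ.≟ o + size (node l r))) ⊎-dec
                         edge? l o a b ⊎-dec edge? r (o + size l) a b

edge-base : ∀ t o → Edge t o o (o + size t)
edge-base leaf       o = refl , refl
edge-base (node l r) o = inj₁ (refl , refl)

edge-base-right : ∀ l r o → Edge r (o + size l) (o + size l) (o + size (node l r))
edge-base-right l r o = subst (Edge r (o + size l) (o + size l)) (+-assoc o (size l) (size r))
  (edge-base r (o + size l))

edge-bounds : ∀ t o {a b} → Edge t o a b → o ≤ a × a < b × b ≤ o + size t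
edge-bounds leaf o (refl , refl) = ≤-refl , m<m+n o (s≤s z≤n) , ≤-refl
edge-bounds t@(node l r) o (inj₁ (refl , refl)) = ≤-refl , m<m+n o (0<size t) , ≤-refl
edge-bounds (node l r) o (inj₂ (inj₁ e)) with o≤a , a<b , b≤ ← edge-bounds l o e =
  o≤a , a<b , ≤-trans b≤ (+-monoʳ-≤ o (m≤m+n (size l) (size r)))
edge-bounds (node l r) o (inj₂ (inj₂ e)) with o≤a , a<b , b≤ ← edge-bounds r (o + size l) e =
  ≤-trans (m≤m+n o (size l)) o≤a , a<b , ≤-trans b≤ (≤-reflexive (+-assoc o (size l) (size r)))

-- The base spans all other edges, and edges of different halves meet at most in the apex.
edge-non-crossing : ∀ t o {a b c d} → Edge t o a b → Edge t o c d → ¬ (a < c × c < b × b < d)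
edge-non-crossing leaf o (_ , refl) (_ , refl) (_ , _ , b<d) = <-irrefl refl b<d
edge-non-crossing t@(node _ _) o (inj₁ (_ , refl)) e (_ , _ , b<d) =
  <⇒≱ b<d (proj₂ (proj₂ (edge-bounds t o e)))
edge-non-crossing t@(node _ _) o e@(inj₂ _) (inj₁ (refl , _)) (a<c , _) =
  <⇒≱ a<c (proj₁ (edge-bounds t o e))
edge-non-crossing (node l r) o (inj₂ (inj₁ e)) (inj₂ (inj₁ f)) = edge-non-crossing l o e f
edge-non-crossing (node l r) o (inj₂ (inj₂ e)) (inj₂ (inj₂ f)) = edge-non-crossing r (o + size l) e f
edge-non-crossing (node l r) o (inj₂ (inj₁ e)) (inj₂ (inj₂ f)) (_ , c<b , _) =
  <⇒≱ c<b (≤-trans (proj₂ (proj₂ (edge-bounds l o e))) (proj₁ (edge-bounds r (o + size l) f)))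
edge-non-crossing (node l r) o (inj₂ (inj₂ e)) (inj₂ (inj₁ f)) (a<c , c<b , b<d) =
  <⇒≱ (<-trans a<c (<-trans c<b b<d))
      (≤-trans (proj₂ (proj₂ (edge-bounds l o f))) (proj₁ (edge-bounds r (o + size l) e)))

edge-side : ∀ t o {a} → o ≤ a → a < o + size t → Edge t o a (suc a)
edge-side leaf o {a} o≤a a<o+1 with refl ← ≤-antisym o≤a (s≤s⁻¹ (≤-trans a<o+1 (≤-reflexive (+-comm o 1)))) =
  refl , +-comm 1 o
edge-side (node l r) o {a} o≤a a< with a ℕ.<? o + size l
... | yes a<l = inj₂ (inj₁ (edge-side l o o≤a a<l))
... | no  a≮l = inj₂ (inj₂ (edge-side r (o + size l) (≮⇒≥ a≮l)
  (≤-trans a< (≤-reflexive (sym (+-assoc o (size l) (size r)))))))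

edge-apex : ∀ t o {a b} → Edge t o a b → suc a < b →
            ∃[ x ] a < x × x < b × Edge t o a x × Edge t o x b
edge-apex leaf o (refl , refl) gap = ⊥-elim (<-irrefl (+-comm 1 o) gap)
edge-apex (node l r) o (inj₁ (refl , refl)) _ =
  o + size l , m<m+n o (0<size l) , +-monoʳ-< o (m<m+n (size l) (0<size r)) ,
  inj₂ (inj₁ (edge-base l o)) , inj₂ (inj₂ (edge-base-right l r o))
edge-apex (node l r) o (inj₂ (inj₁ e)) gap with x , a<x , x<b , ax , xb ← edge-apex l o e gap =
  x , a<x , x<b , inj₂ (inj₁ ax) , inj₂ (inj₁ xb)
edge-apex (node l r) o (inj₂ (inj₂ e)) gap with x , a<x , x<b , ax , xb ← edge-apex r (o + size l) e gap =
  x , a<x , x<b , inj₂ (inj₂ ax) , inj₂ (inj₂ xb)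

module _ (t₁ t₂ : Tree) where
  private
    t : Tree
    t = node t₁ t₂
    N : ℕ
    N = suc (size t)

  Diagonalₜ : (i j : Fin N) → Set
  Diagonalₜ i j = Edge t 0 (toℕ i) (toℕ j) × ¬ Side i j

  Joinedₜ : (i j : Fin N) → Set
  Joinedₜ i j = Side i j ⊎ Diagonalₜ i j

  joined⇒edge : ∀ {i j} → Joinedₜ i j → Edge t 0 (toℕ i) (toℕ j)
  joined⇒edge {i} {j} (inj₁ (inj₁ i⋖j)) = subst (Edge t 0 (toℕ i)) i⋖j
    (edge-side t 0 z≤n (≤-trans (≤-reflexive i⋖j) (s≤s⁻¹ (Fin.toℕ<n j))))
  joined⇒edge (inj₁ (inj₂ (i≡0 , j≡))) = inj₁ (i≡0 , suc-injective j≡)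
  joined⇒edge (inj₂ (e , _)) = e

  edge⇒joined : ∀ {i j} → Edge t 0 (toℕ i) (toℕ j) → Joinedₜ i j
  edge⇒joined {i} {j} e with side? i j
  ... | yes s  = inj₁ s
  ... | no  ¬s = inj₂ (e , ¬s)

  -- The apex x over the base of a piece can only be a corner next to both
  -- ends of the base, since otherwise it would see one of them across a side
  -- or along a diagonal of the piece.
  piece-is-triangle : ∀ {k} → 3 ≤ k → Piece Joinedₜ k → k ≡ 3
  piece-is-triangle {suc zero} (s≤s ()) _
  piece-is-triangle {suc (suc zero)} (s≤s (s≤s ())) _
  piece-is-triangle {suc (suc (suc m))} _ p = result
    where
    open Piece p
    last : Fin (3 + m)
    last = fromℕ (2 + m)
    toℕ-last : toℕ last ≡ 2 + m
    toℕ-last = Fin.toℕ-fromℕ (2 + m)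
    one = Fin.suc {suc (suc m)} zero
    one<last : one Fin.< last
    one<last = s≤s (s≤s z≤n)
    zero<last : zero {2 + m} Fin.< last
    zero<last = s≤s z≤n
    side-edge : ∀ {a b} → a Fin.< b → Side a b → Edge t 0 (toℕ (corner a)) (toℕ (corner b))
    side-edge a<b s = joined⇒edge (Equivalence.from (sides-only a<b) s)
    edge-side′ : ∀ {a b} → a Fin.< b → Edge t 0 (toℕ (corner a)) (toℕ (corner b)) → Side a b
    edge-side′ a<b e = Equivalence.to (sides-only a<b) (edge⇒joined e)
    cross = edge-non-crossing t 0
    result : 3 + m ≡ 3
    result with x , 0<x , x<last , 0x , xl ← edge-apex t 0
                  (side-edge zero<last (inj₂ (refl , cong suc toℕ-last)))
                  (≤-<-trans (increasing {zero} {one} (s≤s z≤n)) (increasing one<last))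
      -- The last corner not beyond x: either x is this corner, or x lies strictly between it and
      -- the next one.
      with a , a≤x , max ← largest (λ b → toℕ (corner b) ℕ.≤? x) {zero} (<⇒≤ 0<x)
      with Fin.<-cmp a last
    ... | tri> _ _ last<a = ⊥-elim (<⇒≱ last<a (≤-trans (s≤s⁻¹ (Fin.toℕ<n a)) (≤-reflexive (sym toℕ-last))))
    ... | tri≈ _ refl _ = ⊥-elim (<⇒≱ x<last a≤x)
    ... | tri< a<last _ _ with m≤n⇒m<n∨m≡n a≤x
    ...   | inj₁ a<x = ⊥-elim (across a a<x a<last max)
      where
      across : ∀ a → toℕ (corner a) < x → a Fin.< last → (∀ {z} → a Fin.< z → ¬ toℕ (corner z) ≤ x) → ⊥
      across zero _ _ max = cross (side-edge {zero} {one} (s≤s z≤n) (inj₁ refl)) xl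
        (0<x , ≰⇒> (max (s≤s z≤n)) , increasing one<last)
      across (suc a) a<x a<last max = cross 0x (side-edge a<b (inj₁ (sym b≡)))
        (increasing {zero} (s≤s z≤n) , a<x , ≰⇒> (max a<b))
        where
        b : Fin (3 + m)
        b = fromℕ< (≤-<-trans a<last (Fin.toℕ<n last))
        b≡ : toℕ b ≡ suc (suc (toℕ a))
        b≡ = Fin.toℕ-fromℕ< (≤-<-trans a<last (Fin.toℕ<n last))
        a<b : suc a Fin.< b
        a<b = ≤-reflexive (sym b≡)
    -- Now x is itself a corner joined to both ends of the base. Being next to both, it is corner 1
    -- and the last corner is 2.
    ...   | inj₂ refl = both a 0<x a<last (edge-side′ a<last xl) 0x
      where
      both : ∀ a → toℕ (corner zero) < toℕ (corner a) → a Fin.< last → Side a last →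
             Edge t 0 (toℕ (corner zero)) (toℕ (corner a)) → 3 + m ≡ 3
      both zero 0<0 _ _ _ = ⊥-elim (<-irrefl refl 0<0)
      both (suc a) _ a<last (inj₁ eq) 0x with edge-side′ {zero} {suc a} (s≤s z≤n) 0x
      ... | inj₁ 1≡a = cong suc (trans (sym toℕ-last) (trans (sym eq) (cong suc (sym 1≡a))))
      ... | inj₂ (_ , a≡) = ⊥-elim (<-irrefl (trans (suc-injective a≡) (sym toℕ-last)) a<last)

  polygon : TriangulatedPolygon
  polygon = record
    { n            = N
    ; 3≤n          = s≤s (+-mono-≤ (0<size t₁) (0<size t₂))
    ; Diagonal     = Diagonalₜ
    ; diagonal?    = λ i j → edge? t 0 (toℕ i) (toℕ j) ×-dec ¬? (side? i j)
    ; ordered      = λ (e , _) → proj₁ (proj₂ (edge-bounds t 0 e))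
    ; not-side     = proj₂
    ; non-crossing = λ (e , _) (f , _) → edge-non-crossing t 0 e f
    ; divided-into-triangles = piece-is-triangle
    }

  open Polygon polygon

  -- Stated for a subtree `s` at offset `o`, so that recursion on `s` is possible; `sub` turns its
  -- edges into edges of the whole tree.
  dissection : ∀ s o {i j} → toℕ i ≡ o → toℕ j ≡ o + size s →
               (∀ {a b} → Edge s o a b → Edge t 0 a b) → Σ (Dissection i j) λ d → shape d ≡ s
  dissection leaf o i≡ j≡ _ = side (trans (cong suc i≡) (trans (+-comm 1 o) (sym j≡))) , refl
  dissection (node l r) o {i} {j} i≡ j≡ sub =
    let k< : o + size l < N
        k< = <-trans (<-≤-trans (+-monoʳ-< o (m<m+n (size l) (0<size r))) (≤-reflexive (sym j≡)))
                     (Fin.toℕ<n j)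
        k≡ = Fin.toℕ-fromℕ< k<
        dˡ , eqˡ = dissection l o i≡ k≡ (sub ∘ inj₂ ∘ inj₁)
        dʳ , eqʳ = dissection r (o + size l) k≡ (trans j≡ (sym (+-assoc o (size l) (size r))))
                     (sub ∘ inj₂ ∘ inj₂)
    in triangle (edge⇒joined (subst₂ (Edge t 0) (sym i≡) (sym j≡) (sub (edge-base (node l r) o)))) dˡ dʳ ,
       cong₂ node eqˡ eqʳ

  labels-polygon : TriangulatedPolygon.labels polygon ≡ quiddity t
  labels-polygon with d , eq ← dissection t 0 {zero} {fromℕ (size t)} refl (Fin.toℕ-fromℕ (size t)) id =
    trans (labels≡quiddity refl (cong suc (Fin.toℕ-fromℕ (size t))) d) (cong quiddity eq)

  trim-trimmed : TrimmedQuidditySequence (trim t)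
  trim-trimmed = endLabel t , polygon , zero , sym (trans (++-identityʳ _) labels-polygon)

-- The labels of the mirrored polygon begin with `endLabel t`. Reading from vertex 1 instead of 0
-- moves this entry to the end, where it is trimmed.
reverse-trim-trimmed : ∀ l r → TrimmedQuidditySequence (reverse (trim (node l r)))
reverse-trim-trimmed l r = endLabel t , polygon (mirror r) (mirror l) , one , sym (begin
  drop (toℕ one) labels ++ take (toℕ one) labels
    ≡⟨ cong₂ (λ v q → drop v q ++ take v q) one≡1 labels≡ ⟩
  reverse (trim t) ∷ʳ endLabel t ∎)
  where
  open ≡-Reasoning
  t = node l r
  labels = TriangulatedPolygon.labels (polygon (mirror r) (mirror l))
  one = fromℕ< {1} (s≤s (0<size (mirror t)))
  one≡1 : toℕ one ≡ 1
  one≡1 = Fin.toℕ-fromℕ< (s≤s (0<size (mirror t)))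
  labels≡ : labels ≡ endLabel t ∷ reverse (trim t)
  labels≡ = begin
    labels                         ≡⟨ labels-polygon (mirror r) (mirror l) ⟩
    quiddity (mirror t)            ≡⟨ quiddity-mirror t ⟩
    reverse (trim t ∷ʳ endLabel t) ≡⟨ reverse-++ (trim t) (endLabel t ∷ []) ⟩
    endLabel t ∷ reverse (trim t)  ∎

-- Dissecting from the side between the last and the first vertex gives the labels read from vertex
-- 0. Reading from `v` is a rotation, which keeps the sign change.
trimmed⇒positive×vanishing : ∀ {w} → TrimmedQuidditySequence w →
  All (0 <_) w × Vanishing w
trimmed⇒positive×vanishing {w} (a , P , v , eq) = positive , vanishing-trim w a monodromy
  where
  open TriangulatedPolygon P
  open Polygon P
  first last : Fin n
  first = fromℕ< (≤-trans (s≤s z≤n) 3≤n)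
  first≡ : toℕ first ≡ 0
  first≡ = Fin.toℕ-fromℕ< _
  last = fromℕ< {n ∸ 1} (∸-monoʳ-< (s≤s z≤n) (≤-trans (s≤s z≤n) 3≤n))
  last≡ : suc (toℕ last) ≡ n
  last≡ = trans (cong suc (Fin.toℕ-fromℕ< _)) (m+[n∸m]≡n (≤-trans (s≤s z≤n) 3≤n))
  first<last : suc (toℕ first) < toℕ last
  first<last = s≤s⁻¹ (subst₂ (λ f l → suc (suc (suc f)) ≤ l) (sym first≡) (sym last≡) 3≤n)
  d : Dissection first last
  d = dissect (<-trans (n<1+n _) first<last) (inj₁ (inj₂ (first≡ , last≡)))
  labels≡ : labels ≡ quiddity (shape d)
  labels≡ = labels≡quiddity first≡ last≡ d
  labels-positive : All (0 <_) labels
  labels-positive = subst (All (0 <_)) (sym labels≡) (go d first<last)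
    where
    -- A bare side has labels 0; it is excluded because at least three vertices leave a gap between
    -- the first and the last.
    go : ∀ {i j} (d : Dissection i j) → suc (toℕ i) < toℕ j → All (0 <_) (quiddity (shape d))
    go (side eq) gap        = ⊥-elim (<-irrefl eq gap)
    go (triangle _ l r) _ = quiddity-positive (shape l) (shape r)
  v′ = toℕ v
  positive : All (0 <_) w
  positive = proj₁ (All.++⁻ w (subst (All (0 <_)) (sym eq)
    (All.++⁺ (All.drop⁺ v′ labels-positive) (All.take⁺ v′ labels-positive))))
  monodromy : ∀ s → run s (w ∷ʳ a) ≡ negate s
  monodromy s = trans (cong (run s) eq) (run-rotate (take v′ labels) (drop v′ labels)
    (λ s → trans (cong (run s) (trans (take++drop≡id v′ labels) labels≡)) (run-quiddity (shape d) s)) s)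

-- Words contained in sets and their reversals

infix-refl : ∀ {x : Word} → x IsSubstringOf x
infix-refl = Infix.fromPointwise (Pointwise.refl refl)

infix-trans : ∀ {x y z : Word} → x IsSubstringOf y → y IsSubstringOf z → x IsSubstringOf z
infix-trans = Infix.trans trans

infix-antisym : ∀ {x y : Word} → x IsSubstringOf y → y IsSubstringOf x → x ≡ y
infix-antisym p q = Pointwise-≡⇒≡ (Infix.antisym (λ e _ → e) p q)

infix-length : ∀ {x y : Word} → length x ≡ length y → x IsSubstringOf y → x ≡ y
infix-length eq p with toView p
... | MkView [] {inf} x≋ [] = trans (Pointwise-≡⇒≡ x≋) (sym (++-identityʳ inf))
... | MkView [] {inf} x≋ (c ∷ suff) with refl ← Pointwise-≡⇒≡ x≋ = ⊥-elim
  (<-irrefl (trans eq (length-++ inf)) (m<m+n (length inf) (s≤s z≤n)))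
... | MkView (c ∷ pref) {inf} x≋ suff with refl ← Pointwise-≡⇒≡ x≋ = ⊥-elim
  (<-irrefl (trans eq (length-++ (c ∷ pref)))
    (s≤s (≤-trans (length-++-≤ˡ inf) (m≤n+m (length (inf ++ suff)) (length pref)))))

infix-reverse : ∀ {x w : Word} → x IsSubstringOf w → reverse x IsSubstringOf reverse w
infix-reverse {x} p with toView p
... | MkView pref {inf} x≋ suff with refl ← Pointwise-≡⇒≡ x≋ =
  subst (reverse x IsSubstringOf_)
    (sym (trans (reverse-++ pref (x ++ suff)) (cong (_++ reverse pref) (reverse-++ x suff))))
    ((reverse suff ++ⁱ infix-refl) ⁱ++ reverse pref)

contains-reverse : ∀ {X} w → w Contains X → reverse w Contains reversal X
contains-reverse w (x , x∈X , x⊑w) = reverse x , ∈-map⁺ reverse x∈X , infix-reverse x⊑w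

reversal-contains : ∀ {X} w → w Contains reversal X → reverse w Contains X
reversal-contains w (x , x∈ , x⊑w) with y , y∈X , refl ← ∈-map⁻ reverse x∈ =
  y , y∈X , subst (_IsSubstringOf reverse w) (reverse-involutive y) (infix-reverse x⊑w)

module _ {R : Rel ℕ 0ℓ} where
  linked-join : ∀ xs {y ys} → Linked R (xs ∷ʳ y) → Linked R (y ∷ ys) → Linked R (xs ++ y ∷ ys)
  linked-join []           _         l = l
  linked-join (x ∷ [])     (r ∷ [-]) l = r ∷ l
  linked-join (x ∷ z ∷ xs) (r ∷ k)   l = r ∷ linked-join (z ∷ xs) k l

  linked-init : ∀ xs {y} → Linked R (xs ∷ʳ y) → Linked R xs
  linked-init []           _       = []
  linked-init (x ∷ [])     _       = [-]
  linked-init (x ∷ z ∷ xs) (r ∷ l) = r ∷ linked-init (z ∷ xs) l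

  linked-substring : ∀ {x a b w} → x ≢ [] → length x ≤ 2 → x IsSubstringOf (a ∷ b ∷ w) →
                     Linked R (a ∷ b ∷ w) → ∃[ c ] ∃[ d ] R c d × x IsSubstringOf (c ∷ d ∷ [])
  linked-substring ne _ (here []) _ = ⊥-elim (ne refl)
  linked-substring _ _ (here (refl ∷ [])) (r ∷ _) = _ , _ , r , here (refl ∷ [])
  linked-substring _ _ (here (refl ∷ refl ∷ [])) (r ∷ _) = _ , _ , r , infix-refl
  linked-substring _ (s≤s (s≤s ())) (here (_ ∷ _ ∷ _ ∷ _)) _
  linked-substring {w = []} _ _ (there p) (r ∷ _) = _ , _ , r , there p
  linked-substring {w = _ ∷ _} ne le (there p) (_ ∷ l) = linked-substring ne le p l

-- Sets of words of length at most two that meet all trimmed sequences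

-- The pairs of `B` as arrows between letters; a word linked by it is a walk, all of whose adjacent
-- pairs lie in `B`.
Follows : WordSet → Rel ℕ 0ℓ
Follows B a b = (a ∷ b ∷ []) ∈ B

-- Only polygons of trees are asked for, read both ways, so that reversal merely exchanges `blocks`
-- and `blocksʳ`.
record Blocking (X : WordSet) : Set where
  field
    nonempty  : All (_≢ []) X
    short     : All (λ x → length x ≤ 2) X
    blocks    : ∀ l r → trim (node l r) Contains X
    blocksʳ   : ∀ l r → reverse (trim (node l r)) Contains X

blocking-reversal : ∀ {X} → Blocking X → Blocking (reversal X)
blocking-reversal {X} bX = record
  { nonempty = All.map⁺ (All.map (λ {x} ne eq → ne (reverse-injective {x = x} eq)) nonempty)
  ; short    = All.map⁺ (All.map (λ {x} → subst (_≤ 2) (sym (length-reverse x))) short)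
  ; blocks   = λ l r → subst (_Contains reversal X) (reverse-involutive (trim (node l r)))
                 (contains-reverse _ (blocksʳ l r))
  ; blocksʳ  = λ l r → contains-reverse (trim (node l r)) (blocks l r)
  }
  where open Blocking bX

-- In fan e m the first vertex, of label m + 1, is the centre of m + 1 adjacent copies of e.
spine fan : Tree → ℕ → Tree
spine e zero    = leaf
spine e (suc m) = fan e m
fan e m = node (spine e m) e

startLabel-spine : ∀ e m → startLabel (spine e m) ≡ m
startLabel-spine e zero    = refl
startLabel-spine e (suc m) = cong suc (startLabel-spine e m)

-- The label of the vertex shared by two adjacent copies of e.
joint : Tree → ℕ
joint e = suc (suc (endLabel e) + startLabel e)

-- After the first copy of e the inner labels repeat `joint e ∷ innerLabels e`, so the first copy
-- and one period suffice. The induction keeps a trailing joint for attaching the next period and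
-- drops it at the end.
linked-fan : ∀ {R : Rel ℕ 0ℓ} e m a →
             Linked R (a ∷ suc (startLabel e) ∷ innerLabels e ∷ʳ joint e) →
             Linked R (joint e ∷ innerLabels e ∷ʳ joint e) → Linked R (a ∷ innerLabels (fan e m))
linked-fan {R} e m a first next = linked-init (a ∷ innerLabels (fan e m)) (go m)
  where
  go : ∀ m → Linked R (a ∷ innerLabels (fan e m) ∷ʳ joint e)
  go zero    = first
  go (suc m) = subst (λ w → Linked R (a ∷ w))
    (sym (++-assoc (innerLabels (fan e m)) (joint e ∷ innerLabels e) (joint e ∷ [])))
    (linked-join (a ∷ innerLabels (fan e m)) (go m) next)

module _ {X} (bX : Blocking X) where
  open Blocking bX

  -- The word of `X` found in the sequence has at most two letters, so it fits into one adjacent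
  -- pair, and these all lie in `B`.
  contains-linked : ∀ {a b w} → (a ∷ b ∷ w) Contains X →
                    ∀ B → Linked (Follows B) (a ∷ b ∷ w) → Any (_Contains X) B
  contains-linked (x , x∈X , x⊑w) B link
    with c , d , cd∈B , x⊑cd ← linked-substring (All.lookup nonempty x∈X) (All.lookup short x∈X) x⊑w link =
    lose cd∈B (x , x∈X , x⊑cd)

  blocks-linked : ∀ l r B → Linked (Follows B) (trim (node l r)) → Any (_Contains X) B
  blocks-linked l r B link with innerLabels l | blocks l r
  -- The split on `innerLabels l` only exposes the second letter of the sequence.
  ... | []    | c = contains-linked c B link
  ... | _ ∷ _ | c = contains-linked c B link

  fresh : ℕ
  fresh = suc (max 0 (concat X))

  not-fresh : ∀ {x} → x ∈ X → All (_≢ fresh) x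
  not-fresh x∈X = All.tabulate λ c∈x c≡ → <-irrefl c≡
    (s≤s (All.lookup (xs≤max 0 (concat X)) (∈-concat⁺′ c∈x x∈X)))

  contains-fresh : ∀ {a} b → (fresh ∷ a ∷ []) Contains X → (a ∷ b ∷ []) Contains X
  contains-fresh b (x , x∈X , p) with not-fresh x∈X | All.lookup nonempty x∈X | p
  ... | _      | ne | here []                 = ⊥-elim (ne refl)
  ... | m ∷ _  | _  | here (refl ∷ _)         = ⊥-elim (m refl)
  ... | _      | ne | there (here [])         = ⊥-elim (ne refl)
  ... | _      | _  | there (here (refl ∷ [])) = x , x∈X , here (refl ∷ [])
  ... | _      | ne | there (there (here [])) = ⊥-elim (ne refl)

  -- Since no word of X has the fresh letter, the word of X in the pair of the
  -- centre and its successor can only consist of that successor.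
  blocks-fan : ∀ e B → Linked (Follows B) (suc (startLabel e) ∷ innerLabels e ∷ʳ joint e) →
               Linked (Follows B) (joint e ∷ innerLabels e ∷ʳ joint e) → Any (_Contains X) B
  blocks-fan e B first next = result
    where
    -- The centre of `fan e m` has label m + 1, which is `fresh`.
    m = max 0 (concat X)
    s = suc (startLabel e)
    B′ = (fresh ∷ s ∷ []) ∷ B
    start : startLabel (fan e m) ≡ fresh
    start = cong suc (startLabel-spine e m)
    from-successor : ∀ xs {y} → Linked (Follows B) (s ∷ xs ∷ʳ y) →
                     (fresh ∷ s ∷ []) Contains X → Any (_Contains X) B
    from-successor []      (r ∷ _) p = lose r (contains-fresh _ p)
    from-successor (_ ∷ _) (r ∷ _) p = lose r (contains-fresh _ p)
    result : Any (_Contains X) B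
    result with blocks-linked (spine e m) e B′
                  (subst (λ a → Linked (Follows B′) (a ∷ innerLabels (fan e m))) (sym start)
                    (linked-fan e m fresh (here refl ∷ Linked.map there first) (Linked.map there next)))
    ... | here p  = from-successor (innerLabels e) first p
    ... | there p = p

-- Forced pairs and the case distinction

ear : Tree
ear = node leaf leaf

follows? : ∀ B a b → Dec (Follows B a b)
follows? B a b = (a ∷ b ∷ []) ∈? B

module _ {X} (bX : Blocking X) where
  -- Linkedness is settled by evaluation, so a use names only the polygon and the pairs.
  hit : ∀ l r B → {True (linked? (follows? B) (trim (node l r)))} → Any (_Contains X) B
  hit l r B {ok} = blocks-linked bX l r B (toWitness ok)

  hit-fan : ∀ e B → {True (linked? (follows? B) (suc (startLabel e) ∷ innerLabels e ∷ʳ joint e))} →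
            {True (linked? (follows? B) (joint e ∷ innerLabels e ∷ʳ joint e))} →
            Any (_Contains X) B
  hit-fan e B {ok₁} {ok₂} = blocks-fan bX e B (toWitness ok₁) (toWitness ok₂)

hit-reversal : ∀ {X B} → Any (_Contains reversal X) B → Any (_Contains X) (reversal B)
hit-reversal = Any.map⁺ ∘ Any.map (λ {w} → reversal-contains w)

module _ {X} (bX : Blocking X) (c₁₂ : (1 ∷ 2 ∷ []) Contains X) where
  private
    ⟨_,_⟩ : ℕ → ℕ → Set
    ⟨ a , b ⟩ = (a ∷ b ∷ []) Contains X

    bXʳ = blocking-reversal bX

    Goal : Set
    Goal = ∃[ O ] O ∈ O₁₋₉ × (O ≼ X ⊎ reversal O ≼ X)

    straight : ∀ {O} → O ∈ O₁₋₉ → All (_Contains X) O → Goal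
    straight O∈ cs = _ , O∈ , inj₁ (All.lookup cs)

    c₁₁ : ⟨ 1 , 1 ⟩
    c₁₁ with here c ← hit bX leaf leaf (pairs ((1 , 1) ∷ [])) = c

    -- From the hexagon (3,1,3,1,3,1).
    13∨31 : Any (_Contains X) (pairs ((1 , 3) ∷ (3 , 1) ∷ []))
    13∨31 = hit bX (node ear ear) leaf _

    -- A fan of single triangles, read backwards: (2,...,2,1,m + 1).
    21∨22 : Any (_Contains X) (pairs ((2 , 1) ∷ (2 , 2) ∷ []))
    21∨22 = hit-reversal (hit-fan bXʳ leaf (pairs ((1 , 2) ∷ (2 , 2) ∷ [])))

    -- From the hexagon (2,1,3,2,1,3).
    21∨13∨32 : Any (_Contains X) (pairs ((2 , 1) ∷ (1 , 3) ∷ (3 , 2) ∷ []))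
    21∨13∨32 = hit bX ear (node leaf ear) _

    -- From the 9-gon whose labels are 4,2,1 three times.
    21∨14∨42 : Any (_Contains X) (pairs ((2 , 1) ∷ (1 , 4) ∷ (4 , 2) ∷ []))
    21∨14∨42 = hit bX (node (node (node leaf ear) (node leaf ear)) leaf) leaf _

    -- From the fan (m + 1,2,1,4,1,4,1,...).
    21∨14∨41 : Any (_Contains X) (pairs ((2 , 1) ∷ (1 , 4) ∷ (4 , 1) ∷ []))
    21∨14∨41 = hit-fan bX ear _

    -- From the 12-gon whose labels are 3,4,2,1 three times.
    21∨13∨34∨42 : Any (_Contains X) (pairs ((2 , 1) ∷ (1 , 3) ∷ (3 , 4) ∷ (4 , 2) ∷ []))
    21∨13∨34∨42 = hit bX (node (node leaf (node s s)) leaf) leaf _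
      where s = node (node leaf ear) leaf

    -- A fan of quadrilaterals, read backwards: (...,2,1,5,2,1,5,2,1,3,m + 1).
    21∨13∨15∨52 : Any (_Contains X) (pairs ((2 , 1) ∷ (1 , 3) ∷ (1 , 5) ∷ (5 , 2) ∷ []))
    21∨13∨15∨52 = hit-reversal
      (hit-fan bXʳ (node ear leaf) (pairs ((1 , 2) ∷ (3 , 1) ∷ (5 , 1) ∷ (2 , 5) ∷ [])))

    O₁∈ : O₁ ∈ O₁₋₉
    O₁∈ = here refl
    O₂∈ : O₂ ∈ O₁₋₉
    O₂∈ = there (here refl)
    O₃∈ : O₃ ∈ O₁₋₉
    O₃∈ = there (there (here refl))
    O₄∈ : O₄ ∈ O₁₋₉
    O₄∈ = there (there (there (here refl)))
    O₅∈ : O₅ ∈ O₁₋₉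
    O₅∈ = there (there (there (there (here refl))))
    O₆∈ : O₆ ∈ O₁₋₉
    O₆∈ = there (there (there (there (there (here refl)))))
    O₇∈ : O₇ ∈ O₁₋₉
    O₇∈ = there (there (there (there (there (there (here refl))))))
    O₈∈ : O₈ ∈ O₁₋₉
    O₈∈ = there (there (there (there (there (there (there (here refl)))))))
    O₉∈ : O₉ ∈ O₁₋₉
    O₉∈ = there (there (there (there (there (there (there (there (here refl))))))))

    -- Together with 11 and 12 only 13 or 31 is missing. The second case leads to the reversal of
    -- `O₁`, the only reversal that occurs once 12 is given.
    from-21 : ⟨ 2 , 1 ⟩ → Goal
    from-21 c₂₁ with 13∨31
    ... | here c₁₃         = straight O₁∈ (c₁₁ ∷ c₁₂ ∷ c₂₁ ∷ c₁₃ ∷ [])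
    ... | there (here c₃₁) = O₁ , O₁∈ , inj₂ (All.lookup {P = _Contains X} (c₁₁ ∷ c₂₁ ∷ c₁₂ ∷ c₃₁ ∷ []))

    from-13 : ⟨ 2 , 2 ⟩ → ⟨ 1 , 3 ⟩ → Goal
    from-13 c₂₂ c₁₃ with 21∨14∨42 | 21∨14∨41
    ... | here c₂₁ | _ = from-21 c₂₁
    ... | there (here c₁₄) | _ =
      straight O₂∈ (c₁₁ ∷ c₁₂ ∷ c₂₂ ∷ c₁₃ ∷ c₁₄ ∷ [])
    ... | there (there (here c₄₂)) | here c₂₁ = from-21 c₂₁
    ... | there (there (here c₄₂)) | there (here c₁₄) =
      straight O₂∈ (c₁₁ ∷ c₁₂ ∷ c₂₂ ∷ c₁₃ ∷ c₁₄ ∷ [])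
    ... | there (there (here c₄₂)) | there (there (here c₄₁)) =
      straight O₃∈ (c₁₁ ∷ c₁₂ ∷ c₂₂ ∷ c₁₃ ∷ c₄₁ ∷ c₄₂ ∷ [])

    -- Apart from the earlier cases, the choice of 15 or 52 is combined with one of 41 and 42, 14
    -- and 42, or 14 and 34. This gives the six sets from `O₄` to `O₉`.
    from-31-32 : ⟨ 2 , 2 ⟩ → ⟨ 3 , 1 ⟩ → ⟨ 3 , 2 ⟩ → Goal
    from-31-32 c₂₂ c₃₁ c₃₂ with 21∨13∨15∨52
    ... | here c₂₁ = from-21 c₂₁
    ... | there (here c₁₃) = from-13 c₂₂ c₁₃
    ... | there (there last) = go last
      where
      with-42 : Any (_Contains X) (pairs ((1 , 5) ∷ (5 , 2) ∷ [])) → ⟨ 4 , 2 ⟩ → Goal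
      with-42 _ c₄₂ with 21∨14∨41
      with-42 _ c₄₂ | here c₂₁ = from-21 c₂₁
      with-42 (here c₁₅) c₄₂ | there (here c₁₄) =
        straight O₆∈ (c₁₁ ∷ c₁₂ ∷ c₂₂ ∷ c₃₁ ∷ c₃₂ ∷ c₁₄ ∷ c₄₂ ∷ c₁₅ ∷ [])
      with-42 (there (here c₅₂)) c₄₂ | there (here c₁₄) =
        straight O₇∈ (c₁₁ ∷ c₁₂ ∷ c₂₂ ∷ c₃₁ ∷ c₃₂ ∷ c₁₄ ∷ c₄₂ ∷ c₅₂ ∷ [])
      with-42 (here c₁₅) c₄₂ | there (there (here c₄₁)) =
        straight O₄∈ (c₁₁ ∷ c₁₂ ∷ c₂₂ ∷ c₃₁ ∷ c₃₂ ∷ c₄₁ ∷ c₄₂ ∷ c₁₅ ∷ [])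
      with-42 (there (here c₅₂)) c₄₂ | there (there (here c₄₁)) =
        straight O₅∈ (c₁₁ ∷ c₁₂ ∷ c₂₂ ∷ c₃₁ ∷ c₃₂ ∷ c₄₁ ∷ c₄₂ ∷ c₅₂ ∷ [])
      with-14-34 : Any (_Contains X) (pairs ((1 , 5) ∷ (5 , 2) ∷ [])) → ⟨ 1 , 4 ⟩ → ⟨ 3 , 4 ⟩ → Goal
      with-14-34 (here c₁₅) c₁₄ c₃₄ =
        straight O₈∈ (c₁₁ ∷ c₁₂ ∷ c₂₂ ∷ c₃₁ ∷ c₃₂ ∷ c₁₄ ∷ c₃₄ ∷ c₁₅ ∷ [])
      with-14-34 (there (here c₅₂)) c₁₄ c₃₄ =
        straight O₉∈ (c₁₁ ∷ c₁₂ ∷ c₂₂ ∷ c₃₁ ∷ c₃₂ ∷ c₁₄ ∷ c₃₄ ∷ c₅₂ ∷ [])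
      go : Any (_Contains X) (pairs ((1 , 5) ∷ (5 , 2) ∷ [])) → Goal
      go last with 21∨14∨42 | 21∨13∨34∨42
      ... | here c₂₁ | _ = from-21 c₂₁
      ... | there (there (here c₄₂)) | _ = with-42 last c₄₂
      ... | there (here c₁₄) | here c₂₁ = from-21 c₂₁
      ... | there (here c₁₄) | there (here c₁₃) = from-13 c₂₂ c₁₃
      ... | there (here c₁₄) | there (there (here c₃₄)) = with-14-34 last c₁₄ c₃₄
      ... | there (here c₁₄) | there (there (there (here c₄₂))) = with-42 last c₄₂

  blocking-12⇒above : Goal
  blocking-12⇒above with 21∨22 | 13∨31 | 21∨13∨32
  ... | here c₂₁         | _                | _                        = from-21 c₂₁
  ... | there (here c₂₂) | here c₁₃         | _                        = from-13 c₂₂ c₁₃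
  ... | there (here c₂₂) | there (here c₃₁) | here c₂₁                 = from-21 c₂₁
  ... | there (here c₂₂) | there (here c₃₁) | there (here c₁₃)         = from-13 c₂₂ c₁₃
  ... | there (here c₂₂) | there (here c₃₁) | there (there (here c₃₂)) = from-31-32 c₂₂ c₃₁ c₃₂

-- Minimality

reversal-involutive : ∀ X → reversal (reversal X) ≡ X
reversal-involutive X = trans (sym (map-∘ X)) (trans (map-cong reverse-involutive X) (map-id X))

≼-reversal : ∀ {X Y} → X ≼ reversal Y → reversal X ≼ Y
≼-reversal X≼Yʳ x∈ with y , y∈X , refl ← ∈-map⁻ reverse x∈ = reversal-contains y (X≼Yʳ y∈X)

blocking⇒above : ∀ {X} → Blocking X → ∃[ O ] O ∈ O₁₋₉ × (O ≼ X ⊎ reversal O ≼ X)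
-- The trimmed sequence (1,2,1) of a quadrilateral forces 12 or 21, and reversing X turns 21 into
-- 12.
blocking⇒above {X} bX with hit bX leaf ear (pairs ((1 , 2) ∷ (2 , 1) ∷ []))
... | here c₁₂ = blocking-12⇒above bX c₁₂
... | there (here c₂₁) with blocking-12⇒above (blocking-reversal bX) (contains-reverse (2 ∷ 1 ∷ []) c₂₁)
...   | O , O∈ , inj₁ O≼ = O , O∈ , inj₂ (≼-reversal O≼)
...   | O , O∈ , inj₂ O≼ = O , O∈ , inj₁ (subst (_≼ X) (reversal-involutive O) (≼-reversal O≼))

setLength-mono : ∀ {X Y : WordSet} → (∀ {x} → x ∈ X → x ∈ Y) → setLength X ≤ setLength Y
setLength-mono {X} {Y} X⊆Y = max≤v⁺ z≤n (All.map⁺ (All.tabulate λ x∈X →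
  All.lookup (xs≤max 0 (map length Y)) (∈-map⁺ length (X⊆Y x∈X))))

setLength-cong : ∀ {X Y} → X ≈ Y → setLength X ≡ setLength Y
setLength-cong {X} {Y} X≈Y =
  ≤-antisym (setLength-mono {X} (Equivalence.to X≈Y)) (setLength-mono {Y} (Equivalence.from X≈Y))

unavoidable⇒blocking : ∀ {X} → UnavoidableOfLength 2 X → Blocking X
unavoidable⇒blocking {X} (uX , len) = record
  { nonempty = nonempty
  ; short    = All.map⁻ (All.map (λ le → ≤-trans le (≤-reflexive len)) (xs≤max 0 (map length X)))
  ; blocks   = λ l r → unavoidable (trim-trimmed l r)
  ; blocksʳ  = λ l r → unavoidable (reverse-trim-trimmed l r)
  }
  where open Unavoidable uX

-- The standard sets are unavoidable and pairwise incomparable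

standard : List WordSet
standard = O₁₋₉ ++ map reversal O₁₋₉

unavoidable⇒above : ∀ {X} → UnavoidableOfLength 2 X → ∃[ S ] S ∈ standard × S ≼ X
unavoidable⇒above uX with blocking⇒above (unavoidable⇒blocking uX)
... | O , O∈ , inj₁ O≼ = O , ∈-++⁺ˡ O∈ , O≼
... | O , O∈ , inj₂ O≼ = reversal O , ∈-++⁺ʳ O₁₋₉ (∈-map⁺ reversal O∈) , O≼

-- Asked for all positive vanishing words instead of trimmed sequences: this class is visibly closed
-- under reversal.
Inevitable : WordSet → Set
Inevitable O = ∀ w → All (0 <_) w → Vanishing w → w Contains O

inevitable : ∀ {O} t → {True (certifies? t O)} → Inevitable O
inevitable t {ok} = certified⇒contains t (toWitness ok)

-- The entries bound the ratio after the letters 1 to 5 and after those from 6 on. For example,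
-- avoiding `O₁`, a letter 1 can only follow a letter from 3 on, where the ratio is at least 2; so
-- it is at least 1 - 1/2 after the 1.
O₁₋₉-inevitable : All Inevitable O₁₋₉
O₁₋₉-inevitable =
  inevitable ((1 , 2) ∷ (1 , 1) ∷ (2 , 1) ∷ (2 , 1) ∷ (3 , 1) ∷ (4 , 1) ∷ []) ∷
  inevitable ((1 , 3) ∷ (3 , 2) ∷ (2 , 1) ∷ (3 , 1) ∷ (2 , 1) ∷ (3 , 1) ∷ []) ∷
  inevitable ((1 , 3) ∷ (3 , 2) ∷ (2 , 1) ∷ (1 , 1) ∷ (2 , 1) ∷ (3 , 1) ∷ []) ∷
  inevitable ((2 , 5) ∷ (5 , 3) ∷ (1 , 2) ∷ (1 , 1) ∷ (3 , 1) ∷ (3 , 1) ∷ []) ∷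
  inevitable ((2 , 5) ∷ (5 , 3) ∷ (1 , 2) ∷ (1 , 1) ∷ (2 , 1) ∷ (3 , 1) ∷ []) ∷
  inevitable ((2 , 5) ∷ (5 , 3) ∷ (1 , 2) ∷ (2 , 1) ∷ (3 , 1) ∷ (3 , 1) ∷ []) ∷
  inevitable ((2 , 5) ∷ (5 , 3) ∷ (1 , 2) ∷ (2 , 1) ∷ (2 , 1) ∷ (3 , 1) ∷ []) ∷
  inevitable ((2 , 5) ∷ (5 , 3) ∷ (1 , 2) ∷ (3 , 1) ∷ (3 , 1) ∷ (3 , 1) ∷ []) ∷
  inevitable ((2 , 5) ∷ (5 , 3) ∷ (1 , 2) ∷ (3 , 1) ∷ (2 , 1) ∷ (3 , 1) ∷ []) ∷
  []

inevitable-reversal : ∀ {O} → Inevitable O → Inevitable (reversal O)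
inevitable-reversal {O} inev w 0<w van =
  subst (_Contains reversal O) (reverse-involutive w) (contains-reverse (reverse w)
    (inev (reverse w) (All.tabulate (All.lookup 0<w ∘ Any.reverse⁻)) (vanishing-reverse w van)))

standard-inevitable : All Inevitable standard
standard-inevitable =
  All.++⁺ O₁₋₉-inevitable (All.map⁺ (All.map inevitable-reversal O₁₋₉-inevitable))

standard-contained : ∀ {S w} → S ∈ standard → TrimmedQuidditySequence w → w Contains S
standard-contained {w = w} S∈ tw =
  let 0<w , van = trimmed⇒positive×vanishing tw in All.lookup standard-inevitable S∈ w 0<w van

PositivePairs : WordSet → Set
PositivePairs S = All (λ x → length x ≡ 2) S × All (All (0 <_)) S × setLength S ≡ 2

positivePairs? : ∀ S → Dec (PositivePairs S)
positivePairs? S =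
  All.all? (λ x → length x ℕ.≟ 2) S ×-dec All.all? (All.all? (0 <?_)) S ×-dec setLength S ℕ.≟ 2

standard-pairs : All PositivePairs standard
standard-pairs = toWitness {a? = All.all? positivePairs? standard} _

standard-length : ∀ {S x} → S ∈ standard → x ∈ S → length x ≡ 2
standard-length S∈ x∈S = All.lookup (proj₁ (All.lookup standard-pairs S∈)) x∈S

standard-unavoidable : ∀ {S} → S ∈ standard → UnavoidableOfLength 2 S
standard-unavoidable {S} S∈ with pos , len ← proj₂ (All.lookup standard-pairs S∈) = record
  { nonempty           = All.tabulate λ x∈S → λ { refl → 0≢1+n (standard-length S∈ x∈S) }
  ; positive           = pos
  ; without-redundancy = λ x∈S y∈S →
      infix-length (trans (standard-length S∈ x∈S) (sym (standard-length S∈ y∈S)))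
  ; unavoidable        = standard-contained S∈
  } , len

standard-incomparable : All (λ S → All (λ S′ → All (_∈ S) S′ → S′ ≡ S) standard) standard
standard-incomparable = toWitness {a? = All.all? (λ S → All.all? (λ S′ →
  All.all? (_∈? S) S′ →-dec ≡-dec (≡-dec ℕ._≟_) S′ S) standard) standard} _

-- All words have length two, so a word of `S` inside a word of `S′` equals it, and `≼` amounts to
-- inclusion.
standard-≼⇒≡ : ∀ {S S′} → S ∈ standard → S′ ∈ standard → S′ ≼ S → S′ ≡ S
standard-≼⇒≡ {S} S∈ S′∈ S′≼S = All.lookup (All.lookup standard-incomparable S∈) S′∈
  (All.tabulate λ x∈S′ → let y , y∈S , y⊑x = S′≼S x∈S′ in
    subst (_∈ S) (infix-length (trans (standard-length S∈ y∈S) (sym (standard-length S′∈ x∈S′))) y⊑x) y∈S)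

≼-trans : ∀ {X Y Z} → X ≼ Y → Y ≼ Z → X ≼ Z
≼-trans X≼Y Y≼Z x∈X with y , y∈Y , y⊑x ← X≼Y x∈X with z , z∈Z , z⊑y ← Y≼Z y∈Y =
  z , z∈Z , infix-trans z⊑y y⊑x

⊆⇒≼ : ∀ {X Y : WordSet} → (∀ {x} → x ∈ X → x ∈ Y) → X ≼ Y
⊆⇒≼ X⊆Y x∈X = _ , X⊆Y x∈X , infix-refl

-- Descend from x to y in `Y` and on to x′ in `X`. Irredundancy gives x′ = x, so x and y are
-- substrings of each other.
≼-antisym-⊆ : ∀ {X Y} → WithoutRedundancy X → X ≼ Y → Y ≼ X → ∀ {x} → x ∈ X → x ∈ Y
≼-antisym-⊆ {Y = Y} irr X≼Y Y≼X x∈X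
  with y , y∈Y , y⊑x ← X≼Y x∈X
  with x′ , x′∈X , x′⊑y ← Y≼X y∈Y
  with refl ← irr x′∈X x∈X (infix-trans x′⊑y y⊑x) =
  subst (_∈ Y) (infix-antisym y⊑x x′⊑y) y∈Y

≼-antisym : ∀ {X Y} → WithoutRedundancy X → WithoutRedundancy Y → X ≼ Y → Y ≼ X → X ≈ Y
≼-antisym irrX irrY X≼Y Y≼X = mk⇔ (≼-antisym-⊆ irrX X≼Y Y≼X) (≼-antisym-⊆ irrY Y≼X X≼Y)

unavoidable-resp-≈ : ∀ {X Y L} → X ≈ Y → UnavoidableOfLength L Y → UnavoidableOfLength L X
unavoidable-resp-≈ {X} {Y} X≈Y (uY , len) = record
  { nonempty           = All.tabulate (All.lookup nonempty ∘ to)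
  ; positive           = All.tabulate (All.lookup positive ∘ to)
  ; without-redundancy = λ x∈X y∈X → without-redundancy (to x∈X) (to y∈X)
  ; unavoidable        = λ tw → let x , x∈Y , x⊑w = unavoidable tw in x , from x∈Y , x⊑w
  } , trans (setLength-cong {X} {Y} X≈Y) len
  where
  open Unavoidable uY
  to : ∀ {x} → x ∈ X → x ∈ Y
  to = Equivalence.to X≈Y
  from : ∀ {x} → x ∈ Y → x ∈ X
  from = Equivalence.from X≈Y

≈-sym : ∀ {X Y : WordSet} → X ≈ Y → Y ≈ X
≈-sym X≈Y = mk⇔ (Equivalence.from X≈Y) (Equivalence.to X≈Y)

-- A minimal X has a standard set below it and so equals it. Conversely, a Y below a standard S has
-- a standard set below it in turn; by incomparability this is S, so Y equals S.
minimal⇔standard : ∀ X → MinimalUnavoidable 2 X ⇔ (∃[ S ] S ∈ standard × X ≈ S)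
minimal⇔standard X = mk⇔ to from
  where
  to : MinimalUnavoidable 2 X → ∃[ S ] S ∈ standard × X ≈ S
  to (uX , minimal) = let S , S∈ , S≼X = unavoidable⇒above uX in
    S , S∈ , ≈-sym {S} (minimal S (standard-unavoidable S∈) S≼X)
  from : ∃[ S ] S ∈ standard × X ≈ S → MinimalUnavoidable 2 X
  from (S , S∈ , X≈S) = uX , minimal
    where
    uX : UnavoidableOfLength 2 X
    uX = unavoidable-resp-≈ X≈S (standard-unavoidable S∈)
    X≼S : X ≼ S
    X≼S = ⊆⇒≼ {X} (Equivalence.to X≈S)
    minimal : ∀ Y → UnavoidableOfLength 2 Y → Y ≼ X → Y ≈ X
    minimal Y uY Y≼X =
      let S′ , S′∈ , S′≼Y = unavoidable⇒above uY
          S′≡S = standard-≼⇒≡ S∈ S′∈ (≼-trans {S′} S′≼Y (≼-trans {Y} Y≼X X≼S))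
      in ≼-antisym (Unavoidable.without-redundancy (proj₁ uY)) (Unavoidable.without-redundancy (proj₁ uX))
           Y≼X (≼-trans {X} X≼S (subst (_≼ Y) S′≡S S′≼Y))

corollaryC : ∀ (X : WordSet) →
    MinimalUnavoidable 2 X ⇔ (∃[ O ] O ∈ O₁₋₉ × (X ≈ O ⊎ X ≈ reversal O))
corollaryC X = mk⇔ (to ∘ Equivalence.to (minimal⇔standard X)) (Equivalence.from (minimal⇔standard X) ∘ from)
  where
  to : ∃[ S ] S ∈ standard × X ≈ S → ∃[ O ] O ∈ O₁₋₉ × (X ≈ O ⊎ X ≈ reversal O)
  to (S , S∈ , X≈S) with ∈-++⁻ O₁₋₉ S∈
  ... | inj₁ O∈ = S , O∈ , inj₁ X≈S
  ... | inj₂ S∈ʳ with O , O∈ , refl ← ∈-map⁻ reversal S∈ʳ = O , O∈ , inj₂ X≈S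
  from : ∃[ O ] O ∈ O₁₋₉ × (X ≈ O ⊎ X ≈ reversal O) → ∃[ S ] S ∈ standard × X ≈ S
  from (O , O∈ , inj₁ X≈O)  = O , ∈-++⁺ˡ O∈ , X≈O
  from (O , O∈ , inj₂ X≈Oʳ) = reversal O , ∈-++⁺ʳ O₁₋₉ (∈-map⁺ reversal O∈) , X≈Oʳ
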